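{- As formal power series in $q$ (equivalently, for $|q|<1$), $$\sum_{m,n\ge 0}\frac{(-1)^n q^{2\binom{m+1}{2}+2\binom{n+1}{2}+2mn-m-n}}{(q;q)_m\,(q^2;q^2)_n}=\frac{1}{(q^2,q^4,q^{10},q^{12};q^{14})_\infty},$$ $$\sum_{m,n\ge 0}\frac{(-1)^n q^{2\binom{m+1}{2}+2\binom{n+1}{2}+2mn+n}}{(q;q)_m\,(q^2;q^2)_n}=\frac{1}{(q^2,q^6,q^{8},q^{12};q^{14})_\infty},$$ $$\sum_{m,n\ge 0}\frac{(-1)^n q^{2\binom{m+1}{2}+2\binom{n+1}{2}+2mn+m+n}}{(q;q)_m\,(q^2;q^2)_n}=\frac{1}{(q^4,q^6,q^{8},q^{10};q^{14})_\infty}.$$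
   Context: For $k\ge 0$, $(a;q)_k=\prod_{j=1}^{k}(1-aq^{j-1})$, $(a;q)_\infty=\prod_{j\ge 1}(1-aq^{j-1})$, and $(a_1,\dots,a_r;q)_\infty=(a_1;q)_\infty\cdots(a_r;q)_\infty$. -}

module Defs where

open import Data.Nat as ℕ using (ℕ; zero; suc; _≤_; _≡ᵇ_; _∸_)
open import Data.Nat.Combinatorics using (_C_)
open import Data.Integer as ℤ using (ℤ; +_; -_)
open import Data.List using (List; []; _∷_; map; upTo; zipWith; foldr)
open import Data.Bool using (if_then_else_)
open import Data.Product using (_×_; ∃-syntax)
open import Relation.Binary.PropositionalEquality using (_≡_)

sumℤ : List ℤ → ℤ
sumℤ = foldr ℤ._+_ (+ 0)

-- Formal power series in q with integer coefficients: n ↦ coefficient of q^n.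
FPS : Set
FPS = ℕ → ℤ

0ₚ 1ₚ : FPS
0ₚ _ = + 0
1ₚ zero = + 1
1ₚ (suc _) = + 0

mono : ℕ → FPS
mono e n = if e ≡ᵇ n then + 1 else + 0

_+ₚ_ _-ₚ_ _*ₚ_ : FPS → FPS → FPS
(f +ₚ g) n = f n ℤ.+ g n
(f -ₚ g) n = f n ℤ.- g n
(f *ₚ g) n = sumℤ (map (λ i → f i ℤ.* g (n ∸ i)) (upTo (suc n)))

scale : ℤ → FPS → FPS
scale c f n = c ℤ.* f n

-- Multiplicative inverse of a power series with constant term 1:
-- c_0 = 1, c_n = - Σ_{i=1}^{n} f_i c_{n-i}.
-- invRev f n = [c_n, c_{n-1}, ..., c_0].
invRev : FPS → ℕ → List ℤ
invRev f zero = + 1 ∷ []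
invRev f (suc n) =
  (- sumℤ (zipWith ℤ._*_ (map (λ i → f (suc i)) (upTo (suc n))) (invRev f n)))
  ∷ invRev f n

inv : FPS → FPS
inv f n with invRev f n
... | []    = + 0
... | c ∷ _ = c

prodₚ : List FPS → FPS
prodₚ = foldr _*ₚ_ 1ₚ

sumₚ : List FPS → FPS
sumₚ = foldr _+ₚ_ 0ₚ

poch : ℕ → ℕ → ℕ → FPS
poch a b k = prodₚ (map (λ j → 1ₚ -ₚ mono (a ℕ.+ b ℕ.* j)) (upTo k))

lhsPartial : (ℕ → ℕ → ℕ) → ℕ → FPS
lhsPartial e K =
  sumₚ (map (λ m → sumₚ (map (λ n →
     scale ((- + 1) ℤ.^ n)
       (mono (e m n) *ₚ (inv (poch 1 1 m) *ₚ inv (poch 2 2 n))))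
     (upTo K))) (upTo K))

rhsPartial : ℕ → ℕ → ℕ → ℕ → ℕ → FPS
rhsPartial a b c d K =
  inv (poch a 14 K *ₚ (poch b 14 K *ₚ (poch c 14 K *ₚ poch d 14 K)))

-- Equality of the q-adic limits (K → ∞) of the two sequences of
-- partial sums / partial products: every coefficient eventually agrees.
Identity : (ℕ → ℕ → ℕ) → ℕ → ℕ → ℕ → ℕ → Set
Identity e a b c d =
  ∀ N → ∃[ K₀ ] ∀ K → K₀ ≤ K → lhsPartial e K N ≡ rhsPartial a b c d K N

quadPart : ℕ → ℕ → ℕ
quadPart m n = 2 ℕ.* (suc m C 2) ℕ.+ 2 ℕ.* (suc n C 2) ℕ.+ 2 ℕ.* m ℕ.* n

exp₁ exp₂ exp₃ : ℕ → ℕ → ℕ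
exp₁ m n = quadPart m n ∸ m ∸ n      -- - m - n  (nonnegative: equals (m+n)^2)
exp₂ m n = quadPart m n ℕ.+ n
exp₃ m n = quadPart m n ℕ.+ m ℕ.+ n

{-# OPTIONS --safe #-}

-- Write Q = q². The double sums are values of
--   G a b = Σ (-1)ⁿ q^((m+n)² + am + bn) / ((q;q)_m (q²;q²)_n),
-- and the q-difference equations of the two denominators give a third-order
-- recurrence in k for G (2k) (2k) whose coefficients are polynomials in Q and Qᵏ.
-- The same recurrence holds for the Rogers–Selberg type series
--   T 3 4 k = Σ (-1)ⁿ Q^(3kn + 7n(n-1)/2 + 4n) (1 - Q^(3(k+2n+1))) (Qⁿ⁺¹;Q)_k,
-- and T 3 4 k ≡ (Q;Q)_∞ G (2k) (2k) modulo q^(N+1) for large k, hence for all k by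
-- descending induction. At k = 0 the Jacobi triple product (base Q⁷) evaluates the series.
--
-- Everything is computed modulo q^(N+1), i.e. in a commutative ring in which q is
-- nilpotent, so that every series and product is finite and boundary terms vanish.
module Submission where

open import Defs

open import Algebra.Bundles using (CommutativeRing)
import Algebra.Properties.AbelianGroup
import Algebra.Properties.CommutativeSemiring.Exp
import Algebra.Properties.Ring
import Algebra.Properties.Semiring.Exp
import Algebra.Properties.Semiring.Mult.TCOptimised
import Algebra.Solver.Ring
open import Algebra.Solver.Ring.AlmostCommutativeRing using (fromCommutativeRing; _-Raw-AlmostCommutative⟶_)
open import Data.Integer as ℤ using (ℤ; +_; -[1+_])
import Data.Integer.Properties as ℤ
import Data.Integer.Solver
open import Data.List using ([]; _∷_; map; upTo; applyUpTo; zipWith)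
import Data.List.Properties as List
import Data.Maybe as Maybe
open import Data.Nat as ℕ using (ℕ; zero; suc; _≤_; z≤n; s≤s)
open import Data.Nat.Combinatorics using (_C_; nCk+nC[k+1]≡[n+1]C[k+1]; nC1≡n)
import Data.Nat.Properties as ℕ
open import Data.Nat.Solver using (module +-*-Solver)
open import Data.Product using (_×_; _,_)
open import Data.Sum using (inj₁; inj₂)
open import Function using (_∘_)
open import Level using (0ℓ)
open import Relation.Binary.PropositionalEquality as ≡ using (_≡_; _≗_)
open import Relation.Nullary.Decidable using (dec⇒maybe)

-- The right-hand sides are the Andrews-Gordon products modulo 7 in base `Q`. Andrews' functions
-- satisfy J_{3,i}(x) - J_{3,i-1}(x) = (xQ)^(i-1) J_{3,4-i}(xQ) with J_{3,0} = 0, and eliminating i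
-- = 1 and i = 2 leaves a third-order relation for J_{3,3}. The three sums correspond to i = 3, 2, 1
-- at x = 1. On the double-sum side a step in either summation index leaves the diagonal of `G`.
-- Eliminating the off-diagonal values cancels the odd powers of q, which is why a relation in Q
-- alone can appear. `G 1 2` is off the diagonal and is recovered from `G 0 0` and `G 4 4`. The
-- relation gives the value at k from those at k + 1, k + 2, k + 3 without division, which is what
-- lets the induction descend. Restricting x to powers of Q removes the second formal variable, and
-- the factor (Q;Q)_∞ then turns every denominator of J into a finite product.

-- Ring solver with integer coefficients for an arbitrary commutative ring.

module IntegerSolver {c ℓ} (R : CommutativeRing c ℓ) where
  open CommutativeRing R
  open Algebra.Properties.Ring ring using (-‿distribˡ-*; -‿distribʳ-*; -0#≈0#; -‿involutive)
  open Algebra.Properties.AbelianGroup +-abelianGroup using (⁻¹-∙-comm)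
  open Algebra.Properties.Semiring.Mult.TCOptimised semiring using (1+×; ×-homo-+; ×1-homo-*) renaming (_×_ to _·_)
  open import Relation.Binary.Reasoning.Setoid setoid

  ⟦_⟧ : ℤ → Carrier
  ⟦ + n ⟧ = n · 1#
  ⟦ -[1+ n ] ⟧ = - (suc n · 1#)

  ⟦⊖⟧ : ∀ m n → ⟦ m ℤ.⊖ n ⟧ ≈ (m · 1#) - (n · 1#)
  ⟦⊖⟧ m zero = sym (trans (+-congˡ -0#≈0#) (+-identityʳ _))
  ⟦⊖⟧ zero (suc n) = sym (+-identityˡ _)
  ⟦⊖⟧ (suc m) (suc n) = begin
    ⟦ suc m ℤ.⊖ suc n ⟧               ≡⟨ ≡.cong ⟦_⟧ (ℤ.[1+m]⊖[1+n]≡m⊖n m n) ⟩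
    ⟦ m ℤ.⊖ n ⟧                       ≈⟨ ⟦⊖⟧ m n ⟩
    a - b                             ≈⟨ +-identityˡ _ ⟨
    0# + (a - b)                      ≈⟨ +-congʳ (-‿inverseʳ 1#) ⟨
    (1# - 1#) + (a - b)               ≈⟨ +-assoc _ _ _ ⟩
    1# + (- 1# + (a - b))             ≈⟨ +-congˡ (+-assoc _ _ _) ⟨
    1# + ((- 1# + a) - b)             ≈⟨ +-congˡ (+-congʳ (+-comm _ _)) ⟩
    1# + ((a - 1#) - b)               ≈⟨ +-congˡ (+-assoc _ _ _) ⟩
    1# + (a + (- 1# - b))             ≈⟨ +-assoc _ _ _ ⟨
    (1# + a) + (- 1# - b)             ≈⟨ +-congˡ (⁻¹-∙-comm _ _) ⟩
    (1# + a) - (1# + b)               ≈⟨ +-cong (1+× m 1#) (-‿cong (1+× n 1#)) ⟨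
    (suc m · 1#) - (suc n · 1#)       ∎
    where
    a = m · 1#
    b = n · 1#

  ⟦⟧-neg : ∀ i → ⟦ ℤ.- i ⟧ ≈ - ⟦ i ⟧
  ⟦⟧-neg (+ zero) = sym -0#≈0#
  ⟦⟧-neg (+ suc n) = refl
  ⟦⟧-neg -[1+ n ] = sym (-‿involutive _)

  ⟦⟧-+ : ∀ i j → ⟦ i ℤ.+ j ⟧ ≈ ⟦ i ⟧ + ⟦ j ⟧
  ⟦⟧-+ (+ m) (+ n) = ×-homo-+ 1# m n
  ⟦⟧-+ (+ m) -[1+ n ] = ⟦⊖⟧ m (suc n)
  ⟦⟧-+ -[1+ m ] (+ n) = trans (⟦⊖⟧ n (suc m)) (+-comm _ _)
  ⟦⟧-+ -[1+ m ] -[1+ n ] = begin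
    - (suc (suc (m ℕ.+ n)) · 1#)        ≡⟨ ≡.cong (λ k → - (k · 1#)) (≡.cong suc (ℕ.+-suc m n)) ⟨
    - ((suc m ℕ.+ suc n) · 1#)          ≈⟨ -‿cong (×-homo-+ 1# (suc m) (suc n)) ⟩
    - (suc m · 1# + suc n · 1#)         ≈⟨ ⁻¹-∙-comm _ _ ⟨
    - (suc m · 1#) - (suc n · 1#)       ∎

  ⟦⟧-+* : ∀ m j → ⟦ + m ℤ.* j ⟧ ≈ ⟦ + m ⟧ * ⟦ j ⟧
  ⟦⟧-+* m (+ n) = trans (reflexive (≡.cong ⟦_⟧ (≡.sym (ℤ.pos-* m n)))) (×1-homo-* m n)
  ⟦⟧-+* m -[1+ n ] = begin
    ⟦ + m ℤ.* -[1+ n ] ⟧          ≡⟨ ≡.cong ⟦_⟧ (ℤ.neg-distribʳ-* (+ m) (+ suc n)) ⟨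
    ⟦ ℤ.- (+ m ℤ.* + suc n) ⟧     ≈⟨ ⟦⟧-neg (+ m ℤ.* + suc n) ⟩
    - ⟦ + m ℤ.* + suc n ⟧         ≈⟨ -‿cong (⟦⟧-+* m (+ suc n)) ⟩
    - (⟦ + m ⟧ * ⟦ + suc n ⟧)     ≈⟨ -‿distribʳ-* _ _ ⟩
    ⟦ + m ⟧ * ⟦ -[1+ n ] ⟧        ∎

  ⟦⟧-* : ∀ i j → ⟦ i ℤ.* j ⟧ ≈ ⟦ i ⟧ * ⟦ j ⟧
  ⟦⟧-* (+ m) j = ⟦⟧-+* m j
  ⟦⟧-* -[1+ m ] j = begin
    ⟦ -[1+ m ] ℤ.* j ⟧            ≡⟨ ≡.cong ⟦_⟧ (ℤ.neg-distribˡ-* (+ suc m) j) ⟨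
    ⟦ ℤ.- (+ suc m ℤ.* j) ⟧       ≈⟨ ⟦⟧-neg (+ suc m ℤ.* j) ⟩
    - ⟦ + suc m ℤ.* j ⟧           ≈⟨ -‿cong (⟦⟧-+* (suc m) j) ⟩
    - (⟦ + suc m ⟧ * ⟦ j ⟧)       ≈⟨ -‿distribˡ-* _ _ ⟩
    ⟦ -[1+ m ] ⟧ * ⟦ j ⟧          ∎

  -- Equality in the ring need not be decidable; with coefficients in ℤ, where it is, the solver can
  -- still recognise terms that cancel.
  morphism : ℤ.+-*-rawRing -Raw-AlmostCommutative⟶ fromCommutativeRing R
  morphism = record
    { ⟦_⟧    = ⟦_⟧
    ; +-homo = ⟦⟧-+
    ; *-homo = ⟦⟧-*
    ; -‿homo = ⟦⟧-neg
    ; 0-homo = refl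
    ; 1-homo = refl
    }

  open Algebra.Solver.Ring ℤ.+-*-rawRing (fromCommutativeRing R) morphism
    (λ i j → Maybe.map (λ i≡j → reflexive (≡.cong ⟦_⟧ i≡j)) (dec⇒maybe (i ℤ.≟ j)))
    public using (Polynomial; solve; _:=_; _:+_; _:-_; _:*_; :-_; _:^_; con)

-- Finite sums, finite products and nilpotent elements.

module FiniteSums {c ℓ} (R : CommutativeRing c ℓ) where
  open CommutativeRing R
  open IntegerSolver R
  open Algebra.Properties.Semiring.Exp semiring
  open Algebra.Properties.CommutativeSemiring.Exp commutativeSemiring using (^-distrib-*)
  open import Relation.Binary.Reasoning.Setoid setoid

  Σ : ℕ → (ℕ → Carrier) → Carrier
  Σ zero    f = 0#
  Σ (suc n) f = f 0 + Σ n (f ∘ suc)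

  Σ-cong : ∀ n {f g} → (∀ i → f i ≈ g i) → Σ n f ≈ Σ n g
  Σ-cong zero    f≈g = refl
  Σ-cong (suc n) f≈g = +-cong (f≈g 0) (Σ-cong n (f≈g ∘ suc))

  Σ-zero : ∀ n {f} → (∀ i → f i ≈ 0#) → Σ n f ≈ 0#
  Σ-zero zero    f≈0 = refl
  Σ-zero (suc n) f≈0 = trans (+-cong (f≈0 0) (Σ-zero n (f≈0 ∘ suc))) (+-identityˡ 0#)

  Σ-add : ∀ n f g → Σ n (λ i → f i + g i) ≈ Σ n f + Σ n g
  Σ-add zero    f g = sym (+-identityˡ 0#)
  Σ-add (suc n) f g = trans (+-congˡ (Σ-add n (f ∘ suc) (g ∘ suc)))
    (solve 4 (λ a b x y → (a :+ b) :+ (x :+ y) := (a :+ x) :+ (b :+ y)) refl _ _ _ _)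

  Σ-sub : ∀ n f g → Σ n (λ i → f i - g i) ≈ Σ n f - Σ n g
  Σ-sub zero    f g = solve 0 (con (+ 0) := con (+ 0) :- con (+ 0)) refl
  Σ-sub (suc n) f g = trans (+-congˡ (Σ-sub n (f ∘ suc) (g ∘ suc)))
    (solve 4 (λ a b x y → (a :- b) :+ (x :- y) := (a :+ x) :- (b :+ y)) refl _ _ _ _)

  Σ-*ˡ : ∀ n a f → Σ n (λ i → a * f i) ≈ a * Σ n f
  Σ-*ˡ zero    a f = sym (zeroʳ a)
  Σ-*ˡ (suc n) a f = trans (+-congˡ (Σ-*ˡ n a (f ∘ suc))) (sym (distribˡ a _ _))

  Σ-suc : ∀ n f → Σ (suc n) f ≈ Σ n f + f n
  Σ-suc zero    f = +-comm _ _
  Σ-suc (suc n) f = trans (+-congˡ (Σ-suc n (f ∘ suc))) (sym (+-assoc _ _ _))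

  -- Vanishing at both ends lets the index move while the cut-off stays the same, as it would in an
  -- infinite sum.
  Σ-shift : ∀ n f → f 0 ≈ 0# → f n ≈ 0# → Σ n f ≈ Σ n (f ∘ suc)
  Σ-shift n f f0≈0 fn≈0 = begin
    Σ n f                  ≈⟨ +-identityʳ _ ⟨
    Σ n f + 0#             ≈⟨ +-congˡ fn≈0 ⟨
    Σ n f + f n            ≈⟨ Σ-suc n f ⟨
    f 0 + Σ n (f ∘ suc)    ≈⟨ +-congʳ f0≈0 ⟩
    0# + Σ n (f ∘ suc)     ≈⟨ +-identityˡ _ ⟩
    Σ n (f ∘ suc)          ∎

  Σ-telescope : ∀ n g {f} → (∀ i → f i ≈ g i - g (suc i)) → g 0 ≈ 0# → g n ≈ 0# → Σ n f ≈ 0#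
  Σ-telescope n g f≈ g0≈0 gn≈0 = begin
    Σ n _                          ≈⟨ Σ-cong n f≈ ⟩
    Σ n (λ i → g i - g (suc i))    ≈⟨ Σ-sub n g (g ∘ suc) ⟩
    Σ n g - Σ n (g ∘ suc)          ≈⟨ +-congʳ (Σ-shift n g g0≈0 gn≈0) ⟩
    Σ n (g ∘ suc) - Σ n (g ∘ suc)  ≈⟨ -‿inverseʳ _ ⟩
    0#                             ∎

  Σ-truncate : ∀ m n f → m ≤ n → (∀ i → m ≤ i → f i ≈ 0#) → Σ n f ≈ Σ m f
  Σ-truncate zero    n       f _         f≈0 = Σ-zero n (λ i → f≈0 i z≤n)
  Σ-truncate (suc m) (suc n) f (s≤s m≤n) f≈0 =
    +-congˡ (Σ-truncate m n (f ∘ suc) m≤n (λ i m≤i → f≈0 (suc i) (s≤s m≤i)))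

  Σ-first : ∀ {n} f → 1 ≤ n → (∀ i → f (suc i) ≈ 0#) → Σ n f ≈ f 0
  Σ-first {suc n} f _ f≈0 = trans (+-congˡ (Σ-zero n f≈0)) (+-identityʳ (f 0))

  Π : ℕ → (ℕ → Carrier) → Carrier
  Π zero    f = 1#
  Π (suc n) f = f 0 * Π n (f ∘ suc)

  Π-cong : ∀ n {f g} → (∀ i → f i ≈ g i) → Π n f ≈ Π n g
  Π-cong zero    f≈g = refl
  Π-cong (suc n) f≈g = *-cong (f≈g 0) (Π-cong n (f≈g ∘ suc))

  Π-suc : ∀ n f → Π (suc n) f ≈ Π n f * f n
  Π-suc zero    f = *-comm _ _
  Π-suc (suc n) f = trans (*-congˡ (Π-suc n (f ∘ suc))) (sym (*-assoc _ _ _))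

  x-y≈0⇒x≈y : ∀ {x y} → x - y ≈ 0# → x ≈ y
  x-y≈0⇒x≈y {x} {y} x-y≈0 = begin
    x          ≈⟨ solve 2 (λ x y → x := (x :- y) :+ y) refl x y ⟩
    x - y + y  ≈⟨ +-congʳ x-y≈0 ⟩
    0# + y     ≈⟨ +-identityˡ y ⟩
    y          ∎

  x-y≈z⇒x≈y+z : ∀ {x y z} → x - y ≈ z → x ≈ y + z
  x-y≈z⇒x≈y+z {x} {y} x-y≈z = trans (solve 2 (λ x y → x := y :+ (x :- y)) refl x y) (+-congˡ x-y≈z)

  x≈y+z⇒y≈x-z : ∀ {x y z} → x ≈ y + z → y ≈ x - z
  x≈y+z⇒y≈x-z {x} {y} {z} x≈y+z = trans (solve 2 (λ y z → y := (y :+ z) :- z) refl y z) (+-congʳ (sym x≈y+z))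

  0*≈0 : ∀ {x} y → x ≈ 0# → x * y ≈ 0#
  0*≈0 y x≈0 = trans (*-congʳ x≈0) (zeroˡ y)

  *0≈0 : ∀ x {y} → y ≈ 0# → x * y ≈ 0#
  *0≈0 x y≈0 = trans (*-congˡ y≈0) (zeroʳ x)

  ^-nilpotent : ∀ {x m n} → x ^ m ≈ 0# → m ≤ n → x ^ n ≈ 0#
  ^-nilpotent {x} {m} {n} xᵐ≈0 m≤n = begin
    x ^ n                 ≡⟨ ≡.cong (x ^_) (ℕ.m+[n∸m]≡n m≤n) ⟨
    x ^ (m ℕ.+ (n ℕ.∸ m)) ≈⟨ ^-homo-* x m (n ℕ.∸ m) ⟩
    x ^ m * _             ≈⟨ 0*≈0 _ xᵐ≈0 ⟩
    0#                    ∎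

  ^^-nilpotent : ∀ {x n} m .{{_ : ℕ.NonZero m}} → x ^ n ≈ 0# → (x ^ m) ^ n ≈ 0#
  ^^-nilpotent {x} {n} m xⁿ≈0 =
    trans (^-assocʳ x m n) (^-nilpotent {x} xⁿ≈0 (ℕ.m≤n*m n m))

  *^-nilpotent : ∀ x y n → x ^ n ≈ 0# → (x * y) ^ n ≈ 0#
  *^-nilpotent x y n xⁿ≈0 = trans (^-distrib-* x y n) (0*≈0 _ xⁿ≈0)

  pochhammer : Carrier → Carrier → ℕ → Carrier
  pochhammer a b n = Π n (λ j → 1# - a * b ^ j)

  pochhammer-cong : ∀ {a a′} b n → a ≈ a′ → pochhammer a b n ≈ pochhammer a′ b n
  pochhammer-cong b n a≈a′ = Π-cong n (λ j → +-congˡ (-‿cong (*-congʳ a≈a′)))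

  pochhammer-suc : ∀ a b n → pochhammer a b (suc n) ≈ pochhammer a b n * (1# - a * b ^ n)
  pochhammer-suc a b n = Π-suc n _

  pochhammer-shift : ∀ a b n → pochhammer a b (suc n) ≈ (1# - a) * pochhammer (a * b) b n
  pochhammer-shift a b n = *-cong (+-congˡ (-‿cong (*-identityʳ a)))
    (Π-cong n (λ j → +-congˡ (-‿cong (sym (*-assoc a b (b ^ j))))))

  pochhammer-0 : ∀ {a} b n → a ≈ 0# → pochhammer a b n ≈ 1#
  pochhammer-0 b zero a≈0 = refl
  pochhammer-0 {a} b (suc n) a≈0 = begin
    pochhammer a b (suc n)                ≈⟨ pochhammer-shift a b n ⟩
    (1# - a) * pochhammer (a * b) b n     ≈⟨ *-cong (+-congˡ (-‿cong a≈0)) (pochhammer-0 b n (0*≈0 b a≈0)) ⟩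
    (1# - 0#) * 1#                        ≈⟨ solve 0 ((con (+ 1) :- con (+ 0)) :* con (+ 1) := con (+ 1)) refl ⟩
    1#                                    ∎

  -- All factors from the m-th on are 1, so a product this long already is (a;b)_∞.
  pochhammer-stable : ∀ a {b m n} → b ^ m ≈ 0# → m ≤ n → pochhammer a b n ≈ pochhammer a b m
  pochhammer-stable a {b} {m} {n} bᵐ≈0 m≤n = begin
    pochhammer a b n                   ≡⟨ ≡.cong (pochhammer a b) (ℕ.m∸n+n≡m m≤n) ⟨
    pochhammer a b ((n ℕ.∸ m) ℕ.+ m)   ≈⟨ stable (n ℕ.∸ m) ⟩
    pochhammer a b m                   ∎
    where
    stable : ∀ k → pochhammer a b (k ℕ.+ m) ≈ pochhammer a b m
    stable zero    = refl
    stable (suc k) = begin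
      pochhammer a b (suc (k ℕ.+ m))                            ≈⟨ pochhammer-suc a b (k ℕ.+ m) ⟩
      pochhammer a b (k ℕ.+ m) * (1# - a * b ^ (k ℕ.+ m))
        ≈⟨ *-congˡ (+-congˡ (-‿cong (*0≈0 a (^-nilpotent {b} bᵐ≈0 (ℕ.m≤n+m m k))))) ⟩
      pochhammer a b (k ℕ.+ m) * (1# - 0#)
        ≈⟨ solve 1 (λ p → p :* (con (+ 1) :- con (+ 0)) := p) refl _ ⟩
      pochhammer a b (k ℕ.+ m)                                  ≈⟨ stable k ⟩
      pochhammer a b m                                          ∎

-- The Jacobi triple product for nilpotent arguments.

module JacobiTripleProduct {c ℓ} (R : CommutativeRing c ℓ) where
  open CommutativeRing R
  open IntegerSolver R
  open FiniteSums R
  open Algebra.Properties.Semiring.Exp semiring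
  open Algebra.Properties.CommutativeSemiring.Exp commutativeSemiring using (^-distrib-*)
  open import Relation.Binary.Reasoning.Setoid setoid

  ρ : Carrier → ℕ → Carrier
  ρ B zero    = 1#
  ρ B (suc n) = - (B ^ n * ρ B n)

  -- σ B x n = (-1)ⁿ B^(n(n-1)/2) xⁿ
  σ : Carrier → Carrier → ℕ → Carrier
  σ B x n = x ^ n * ρ B n

  σ-suc : ∀ B x n → σ B x (suc n) ≈ - (x * B ^ n * σ B x n)
  σ-suc B x n = solve 4 (λ x y b r → (x :* y) :* (:- (b :* r)) := :- (x :* b :* (y :* r))) refl _ _ _ _

  module _ (B : Carrier) (N : ℕ) (Bᴺ≈0 : B ^ N ≈ 0#) where

    -- (Bʲ⁺¹; B)_∞: the factors beyond the N-th are 1 because Bᴺ ≈ 0.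
    tail : ℕ → Carrier
    tail j = pochhammer (B ^ suc j) B N

    tail-step : ∀ j → tail j ≈ (1# - B ^ suc j) * tail (suc j)
    tail-step j = begin
      pochhammer (B ^ suc j) B N           ≈⟨ pochhammer-stable _ Bᴺ≈0 (ℕ.n≤1+n N) ⟨
      pochhammer (B ^ suc j) B (suc N)     ≈⟨ pochhammer-shift _ B N ⟩
      (1# - B ^ suc j) * pochhammer (B ^ suc j * B) B N
        ≈⟨ *-congˡ (pochhammer-cong B N (*-comm _ _)) ⟩
      (1# - B ^ suc j) * tail (suc j)      ∎

    tail-one : ∀ j → N ≤ j → tail j ≈ 1#
    tail-one j N≤j = pochhammer-0 B N (^-nilpotent {B} Bᴺ≈0 (ℕ.m≤n⇒m≤1+n N≤j))

    -- Euler's series Σ (-1)^j B^(j(j-1)/2) x^j / (B;B)_j multiplied by (B;B)_∞, so that each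
    -- quotient becomes a tail product and nothing is divided.
    E : Carrier → ℕ → Carrier
    E x J = Σ J (λ j → σ B x j * tail j)

    E-step : ∀ x J → x ^ J ≈ 0# → E x J ≈ (1# - x) * E (x * B) J
    E-step x J xᴶ≈0 = x-y≈0⇒x≈y (begin
      E x J - (1# - x) * E (x * B) J    ≈⟨ +-congˡ (-‿cong (Σ-*ˡ J (1# - x) _)) ⟨
      E x J - Σ J (λ j → (1# - x) * (σ B (x * B) j * tail j))   ≈⟨ Σ-sub J _ _ ⟨
      Σ J (λ j → σ B x j * tail j - (1# - x) * (σ B (x * B) j * tail j))
        -- The telescoping quantity vanishes at j = 0 through 1 - B^0 and at j = J through x^J.
        ≈⟨ Σ-telescope J (λ j → (1# - B ^ j) * σ B x j * tail j) step
             (solve 2 (λ s t → (con (+ 1) :- con (+ 1)) :* s :* t := con (+ 0)) refl _ _)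
             (0*≈0 _ (*0≈0 _ (0*≈0 _ xᴶ≈0))) ⟩
      0#                                ∎)
      where
      step : ∀ j → σ B x j * tail j - (1# - x) * (σ B (x * B) j * tail j)
             ≈ (1# - B ^ j) * σ B x j * tail j - (1# - B ^ suc j) * σ B x (suc j) * tail (suc j)
      step j = begin
        σ B x j * tail j - (1# - x) * ((x * B) ^ j * ρ B j * tail j)
          ≈⟨ +-congˡ (-‿cong (*-congˡ (*-congʳ (*-congʳ (^-distrib-* x B j))))) ⟩
        σ B x j * tail j - (1# - x) * ((x ^ j * B ^ j) * ρ B j * tail j)
          ≈⟨ solve 5 (λ x y b r t → (y :* r) :* t :- (con (+ 1) :- x) :* ((y :* b) :* r :* t)
               := (con (+ 1) :- b) :* (y :* r) :* t :- (:- (x :* b :* (y :* r))) :* t) refl _ _ _ _ _ ⟩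
        (1# - B ^ j) * σ B x j * tail j - (- (x * B ^ j * σ B x j)) * tail j
          ≈⟨ +-congˡ (-‿cong (*-cong (sym (σ-suc B x j)) (tail-step j))) ⟩
        (1# - B ^ j) * σ B x j * tail j - σ B x (suc j) * ((1# - B ^ suc j) * tail (suc j))
          ≈⟨ +-congˡ (-‿cong (solve 3 (λ s b t → s :* (b :* t) := b :* s :* t) refl _ _ _)) ⟩
        (1# - B ^ j) * σ B x j * tail j - (1# - B ^ suc j) * σ B x (suc j) * tail (suc j) ∎

    E-iterate : ∀ x J n → x ^ J ≈ 0# → E x J ≈ pochhammer x B n * E (x * B ^ n) J
    E-iterate x J zero xᴶ≈0 = sym (trans (*-identityˡ _)
      (Σ-cong J (λ j → *-congʳ (*-congʳ (^-congˡ j (*-identityʳ x))))))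
    E-iterate x J (suc n) xᴶ≈0 = begin
      E x J                                              ≈⟨ E-step x J xᴶ≈0 ⟩
      (1# - x) * E (x * B) J                             ≈⟨ *-congˡ (E-iterate (x * B) J n (*^-nilpotent x B J xᴶ≈0)) ⟩
      (1# - x) * (pochhammer (x * B) B n * E (x * B * B ^ n) J)
        ≈⟨ *-congˡ (*-congˡ (Σ-cong J (λ j → *-congʳ (*-congʳ (^-congˡ j (*-assoc x B (B ^ n))))))) ⟩
      (1# - x) * (pochhammer (x * B) B n * E (x * B ^ suc n) J)  ≈⟨ *-assoc _ _ _ ⟨
      (1# - x) * pochhammer (x * B) B n * E (x * B ^ suc n) J    ≈⟨ *-congʳ (pochhammer-shift x B n) ⟨
      pochhammer x B (suc n) * E (x * B ^ suc n) J       ∎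

    E-0 : ∀ {x} J → x ≈ 0# → E x (suc J) ≈ tail 0
    E-0 {x} J x≈0 = begin
      (1# * 1#) * tail 0 + Σ J _     ≈⟨ +-congˡ (Σ-zero J (λ j → 0*≈0 _ (0*≈0 _ (0*≈0 _ x≈0)))) ⟩
      (1# * 1#) * tail 0 + 0#        ≈⟨ solve 1 (λ t → (con (+ 1) :* con (+ 1)) :* t :+ con (+ 0) := t) refl _ ⟩
      tail 0                         ∎

    euler : ∀ x J → x ^ suc J ≈ 0# → E x (suc J) ≈ pochhammer x B N * tail 0
    euler x J xᴶ≈0 = trans (E-iterate x (suc J) N xᴶ≈0) (*-congˡ (E-0 J (*0≈0 x Bᴺ≈0)))

    module _ (z w : Carrier) (z*w≈B : z * w ≈ B) (zᴺ≈0 : z ^ N ≈ 0#) (wᴺ≈0 : w ^ N ≈ 0#) where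

      -- The term of index j - k of the bilateral theta series.
      θ : ℕ → ℕ → Carrier
      θ zero    k       = σ B w k
      θ (suc j) zero    = σ B z (suc j)
      θ (suc j) (suc k) = θ j k

      θ-zero : ∀ j → θ j 0 ≈ σ B z j
      θ-zero zero    = refl
      θ-zero (suc j) = refl

      -- The ratio of neighbouring theta terms, cleared of denominators. Since z is nilpotent, w has
      -- to stand in for B/z; `z*w≈B` enters at positive index j - k.
      θ-step : ∀ j k → w * B ^ k * θ j k ≈ - (B ^ j * θ j (suc k))
      θ-step zero k = begin
        w * B ^ k * σ B w k         ≈⟨ solve 1 (λ x → x := :- (con (+ 1) :* (:- x))) refl _ ⟩
        - (1# * - (w * B ^ k * σ B w k)) ≈⟨ -‿cong (*-congˡ (σ-suc B w k)) ⟨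
        - (1# * σ B w (suc k))      ∎
      θ-step (suc j) zero = begin
        w * 1# * σ B z (suc j)            ≈⟨ *-congˡ (σ-suc B z j) ⟩
        w * 1# * - (z * B ^ j * σ B z j)
          ≈⟨ solve 4 (λ w z b s → w :* con (+ 1) :* (:- (z :* b :* s)) := :- ((z :* w) :* b :* s)) refl _ _ _ _ ⟩
        - ((z * w) * B ^ j * σ B z j)     ≈⟨ -‿cong (*-cong (*-congʳ z*w≈B) (sym (θ-zero j))) ⟩
        - (B * B ^ j * θ j 0)             ∎
      θ-step (suc j) (suc k) = begin
        w * (B * B ^ k) * θ j k           ≈⟨ solve 4 (λ w B b t → w :* (B :* b) :* t := B :* (w :* b :* t)) refl _ _ _ _ ⟩
        B * (w * B ^ k * θ j k)           ≈⟨ *-congˡ (θ-step j k) ⟩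
        B * - (B ^ j * θ j (suc k))       ≈⟨ solve 3 (λ B b t → B :* (:- (b :* t)) := :- (B :* b :* t)) refl _ _ _ ⟩
        - (B * B ^ j * θ j (suc k))       ∎

      θ-upper : ∀ k n → N ≤ n → θ (k ℕ.+ n) k ≈ 0#
      θ-upper zero    n N≤n = trans (θ-zero n) (0*≈0 _ (^-nilpotent {z} zᴺ≈0 N≤n))
      θ-upper (suc k) n N≤n = θ-upper k n N≤n

      θ-lower : ∀ j n → N ≤ n → θ j (j ℕ.+ n) ≈ 0#
      θ-lower zero    n N≤n = 0*≈0 _ (^-nilpotent {w} wᴺ≈0 N≤n)
      θ-lower (suc j) n N≤n = θ-lower j n N≤n

      -- Interpolates between Euler's series in z, at k = 0, and the whole theta series: as k grows,
      -- the nonzero theta terms move to large j, where `tail j` is 1.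
      V : ℕ → ℕ → Carrier
      V J k = Σ J (λ j → θ j k * tail j)

      V-step : ∀ J k → suc k ℕ.+ N ≤ J → V J (suc k) ≈ (1# - w * B ^ k) * V J k
      V-step J k k+N<J = x-y≈0⇒x≈y (begin
        V J (suc k) - (1# - w * B ^ k) * V J k      ≈⟨ +-congˡ (-‿cong (Σ-*ˡ J _ _)) ⟨
        V J (suc k) - Σ J (λ j → (1# - w * B ^ k) * (θ j k * tail j))   ≈⟨ Σ-sub J _ _ ⟨
        Σ J (λ j → θ j (suc k) * tail j - (1# - w * B ^ k) * (θ j k * tail j))
          -- `θ (suc j) (suc k)` unfolds to `θ j k`, so the shifted summand supplies the terms of
          -- `V J k`.
          ≈⟨ Σ-telescope J (λ j → (1# - B ^ j) * θ j (suc k) * tail j) step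
               (solve 2 (λ s t → (con (+ 1) :- con (+ 1)) :* s :* t := con (+ 0)) refl _ _)
               (0*≈0 _ (*0≈0 _ θJ≈0)) ⟩
        0#                                          ∎)
        where
        θJ≈0 : θ J (suc k) ≈ 0#
        θJ≈0 = ≡.subst (λ J → θ J (suc k) ≈ 0#)
          (ℕ.m+[n∸m]≡n (ℕ.m+n≤o⇒m≤o (suc k) k+N<J))
          (θ-upper (suc k) (J ℕ.∸ suc k) (ℕ.m+n≤o⇒m≤o∸n N (≡.subst (_≤ J) (ℕ.+-comm (suc k) N) k+N<J)))
        step : ∀ j → θ j (suc k) * tail j - (1# - w * B ^ k) * (θ j k * tail j)
               ≈ (1# - B ^ j) * θ j (suc k) * tail j - (1# - B ^ suc j) * θ j k * tail (suc j)
        step j = begin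
          θ j (suc k) * tail j - (1# - w * B ^ k) * (θ j k * tail j)
            ≈⟨ solve 4 (λ t s a b → t :* s :- (con (+ 1) :- a) :* (b :* s) := t :* s :+ (a :* b) :* s :- b :* s) refl _ _ _ _ ⟩
          θ j (suc k) * tail j + (w * B ^ k * θ j k) * tail j - θ j k * tail j
            ≈⟨ +-cong (+-congˡ (*-congʳ (θ-step j k))) (-‿cong (*-congˡ (tail-step j))) ⟩
          θ j (suc k) * tail j + (- (B ^ j * θ j (suc k))) * tail j - θ j k * ((1# - B ^ suc j) * tail (suc j))
            ≈⟨ solve 6 (λ t s b x y u → t :* s :+ (:- (b :* t)) :* s :- x :* (y :* u) := (con (+ 1) :- b) :* t :* s :- y :* x :* u) refl _ _ _ _ _ _ ⟩
          (1# - B ^ j) * θ j (suc k) * tail j - (1# - B ^ suc j) * θ j k * tail (suc j) ∎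

      V-iterate : ∀ J k → k ℕ.+ N ≤ J → V J k ≈ pochhammer w B k * E z J
      V-iterate J zero    _     = trans (Σ-cong J (λ j → *-congʳ (θ-zero j))) (sym (*-identityˡ _))
      V-iterate J (suc k) k+N<J = begin
        V J (suc k)                                         ≈⟨ V-step J k k+N<J ⟩
        (1# - w * B ^ k) * V J k                            ≈⟨ *-congˡ (V-iterate J k (ℕ.<⇒≤ k+N<J)) ⟩
        (1# - w * B ^ k) * (pochhammer w B k * E z J)
          ≈⟨ solve 3 (λ a b c → a :* (b :* c) := (b :* a) :* c) refl _ _ _ ⟩
        pochhammer w B k * (1# - w * B ^ k) * E z J         ≈⟨ *-congʳ (pochhammer-suc w B k) ⟨
        pochhammer w B (suc k) * E z J                      ∎

      -- Either j ≥ N and the tail is 1, or the theta index j - 2N is at most -N and the term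
      -- vanishes.
      θ-tail : ∀ j → θ j (N ℕ.+ N) * tail j ≈ θ j (N ℕ.+ N)
      θ-tail j with ℕ.≤-total N j
      ... | inj₁ N≤j = trans (*-congˡ (tail-one j N≤j)) (*-identityʳ _)
      ... | inj₂ j≤N = trans (0*≈0 _ θ≈0) (sym θ≈0)
        where
        θ≈0 : θ j (N ℕ.+ N) ≈ 0#
        θ≈0 = ≡.subst (λ k → θ j k ≈ 0#) (ℕ.m+[n∸m]≡n (ℕ.≤-trans j≤N (ℕ.m≤m+n N N)))
          (θ-lower j (N ℕ.+ N ℕ.∸ j) (ℕ.m+n≤o⇒m≤o∸n N (ℕ.+-monoʳ-≤ N j≤N)))

      Σ-θ : ∀ k n → Σ (k ℕ.+ n) (λ j → θ j k) ≈ Σ k (σ B w ∘ suc) + Σ n (σ B z)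
      Σ-θ zero    n = trans (Σ-cong n θ-zero) (sym (+-identityˡ _))
      Σ-θ (suc k) n = begin
        σ B w (suc k) + Σ (k ℕ.+ n) (λ j → θ j k)                    ≈⟨ +-congˡ (Σ-θ k n) ⟩
        σ B w (suc k) + (Σ k (σ B w ∘ suc) + Σ n (σ B z))
          ≈⟨ solve 3 (λ a b c → a :+ (b :+ c) := (b :+ a) :+ c) refl _ _ _ ⟩
        Σ k (σ B w ∘ suc) + σ B w (suc k) + Σ n (σ B z)              ≈⟨ +-congʳ (Σ-suc k _) ⟨
        Σ (suc k) (σ B w ∘ suc) + Σ n (σ B z)                        ∎

      -- The bilateral series is folded by pairing index n with -(n + 1), the form in which the
      -- theta series of the other side arrives.
      jacobi : Σ N (λ n → σ B z n + σ B w (suc n)) ≈ pochhammer B B N * (pochhammer z B N * pochhammer w B N)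
      jacobi = begin
        Σ N (λ n → σ B z n + σ B w (suc n))              ≈⟨ Σ-add N _ _ ⟩
        Σ N (σ B z) + Σ N (σ B w ∘ suc)
          -- Padding with zero terms: 2N negative indices match `V` at k = 2N, and N + 1 nonnegative
          -- ones keep the range of `euler` visibly nonempty.
          ≈⟨ +-cong (Σ-truncate N (suc N) _ (ℕ.n≤1+n N) (λ i N≤i → 0*≈0 _ (^-nilpotent {z} zᴺ≈0 N≤i)))
                    (Σ-truncate N (N ℕ.+ N) _ (ℕ.m≤m+n N N)
                      (λ i N≤i → 0*≈0 _ (^-nilpotent {w} wᴺ≈0 (ℕ.m≤n⇒m≤1+n N≤i)))) ⟨
        Σ (suc N) (σ B z) + Σ (N ℕ.+ N) (σ B w ∘ suc)    ≈⟨ +-comm _ _ ⟩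
        Σ (N ℕ.+ N) (σ B w ∘ suc) + Σ (suc N) (σ B z)    ≈⟨ Σ-θ (N ℕ.+ N) (suc N) ⟨
        Σ (N ℕ.+ N ℕ.+ suc N) (λ j → θ j (N ℕ.+ N))      ≈⟨ Σ-cong (N ℕ.+ N ℕ.+ suc N) θ-tail ⟨
        V (N ℕ.+ N ℕ.+ suc N) (N ℕ.+ N)
          ≈⟨ V-iterate _ (N ℕ.+ N) (ℕ.+-monoʳ-≤ (N ℕ.+ N) (ℕ.n≤1+n N)) ⟩
        pochhammer w B (N ℕ.+ N) * E z (N ℕ.+ N ℕ.+ suc N)
          ≡⟨ ≡.cong (λ J → pochhammer w B (N ℕ.+ N) * E z J) (ℕ.+-suc (N ℕ.+ N) N) ⟩
        pochhammer w B (N ℕ.+ N) * E z (suc (N ℕ.+ N ℕ.+ N))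
          ≈⟨ *-cong (pochhammer-stable w Bᴺ≈0 (ℕ.m≤m+n N N))
                    (euler z (N ℕ.+ N ℕ.+ N) (^-nilpotent {z} zᴺ≈0 (ℕ.m≤n⇒m≤1+n (ℕ.m≤n+m N (N ℕ.+ N))))) ⟩
        pochhammer w B N * (pochhammer z B N * tail 0)
          ≈⟨ solve 3 (λ a b c → a :* (b :* c) := c :* (b :* a)) refl _ _ _ ⟩
        tail 0 * (pochhammer z B N * pochhammer w B N)
          ≈⟨ *-congʳ (pochhammer-cong B N (*-identityʳ B)) ⟩
        pochhammer B B N * (pochhammer z B N * pochhammer w B N) ∎

-- Arithmetic of the quadratic exponents.

module Exponents where
  open import Data.Nat using (_+_; _*_)
  open import Data.Nat.Properties
  open +-*-Solver using (solve; _:+_; _:*_; _:=_; con)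
  open ≡ using (_≡_; refl; subst)

  e : ℕ → ℕ → ℕ → ℕ → ℕ
  e a b m n = (m + n) * (m + n) + a * m + b * n

  e-swap : ∀ a b m n → e b a n m ≡ e a b m n
  e-swap = solve 4 (λ a b m n →
    (n :+ m) :* (n :+ m) :+ b :* n :+ a :* m := (m :+ n) :* (m :+ n) :+ a :* m :+ b :* n) refl

  e-sucˡ : ∀ a b m n → e a b (suc m) n ≡ suc a + e (2 + a) (2 + b) m n
  e-sucˡ = solve 4 (λ a b m n →
    (con 1 :+ m :+ n) :* (con 1 :+ m :+ n) :+ a :* (con 1 :+ m) :+ b :* n
    := con 1 :+ a :+ ((m :+ n) :* (m :+ n) :+ (con 2 :+ a) :* m :+ (con 2 :+ b) :* n)) refl

  e-sucʳ : ∀ a b m n → e a b m (suc n) ≡ suc b + e (2 + a) (2 + b) m n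
  e-sucʳ = solve 4 (λ a b m n →
    (m :+ (con 1 :+ n)) :* (m :+ (con 1 :+ n)) :+ a :* m :+ b :* (con 1 :+ n)
    := con 1 :+ b :+ ((m :+ n) :* (m :+ n) :+ (con 2 :+ a) :* m :+ (con 2 :+ b) :* n)) refl

  e-addˡ : ∀ a b m n → e (suc a) b m n ≡ e a b m n + m
  e-addˡ = solve 4 (λ a b m n →
    (m :+ n) :* (m :+ n) :+ (con 1 :+ a) :* m :+ b :* n
    := (m :+ n) :* (m :+ n) :+ a :* m :+ b :* n :+ m) refl

  e-addʳ : ∀ a b m n → e a (2 + b) m n ≡ e a b m n + 2 * n
  e-addʳ = solve 4 (λ a b m n →
    (m :+ n) :* (m :+ n) :+ a :* m :+ (con 2 :+ b) :* n
    := (m :+ n) :* (m :+ n) :+ a :* m :+ b :* n :+ con 2 :* n) refl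

  theta-exponent : ∀ i j n → n * j + (n + n + 1) * i ≡ i * suc n + (i + j) * n
  theta-exponent = solve 3 (λ i j n →
    n :* j :+ (n :+ n :+ con 1) :* i := i :* (con 1 :+ n) :+ (i :+ j) :* n) refl

  -- With q^K = 0 this kills the boundary terms at the cut-off.
  m≤e : ∀ a b m n → m ≤ e a b m n
  m≤e a b zero    n = z≤n
  m≤e a b (suc m) n = begin
    suc m                                  ≤⟨ m≤m+n (suc m) n ⟩
    suc m + n                              ≤⟨ m≤m*n (suc m + n) (suc m + n) ⟩
    (suc m + n) * (suc m + n)              ≤⟨ m≤m+n _ (a * suc m) ⟩
    (suc m + n) * (suc m + n) + a * suc m  ≤⟨ m≤m+n _ (b * n) ⟩
    e a b (suc m) n                        ∎
    where open ≤-Reasoning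

  n≤e : ∀ a b m n → n ≤ e a b m n
  n≤e a b m n = subst (n ≤_) (e-swap a b m n) (m≤e b a n m)

-- The q-difference equations of the double sum.

module DoubleSum {c ℓ} (R : CommutativeRing c ℓ) where
  open CommutativeRing R
  open Exponents
  open IntegerSolver R
  open FiniteSums R
  open Algebra.Properties.Semiring.Exp semiring using (_^_; ^-homo-*; ^-assocʳ)
  open import Relation.Binary.Reasoning.Setoid setoid

  module WithInverses
    (q : Carrier) (K : ℕ) (1≤K : 1 ≤ K) (qᴷ≈0 : q ^ K ≈ 0#)
    (u v : ℕ → Carrier) (u-zero : u 0 ≈ 1#) (v-zero : v 0 ≈ 1#)
    (u-suc : ∀ m → (1# - q ^ suc m) * u (suc m) ≈ u m)
    (v-suc : ∀ n → (1# - (q ^ 2) ^ suc n) * v (suc n) ≈ v n)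
    where

    sgn : ℕ → Carrier
    sgn zero    = 1#
    sgn (suc n) = - sgn n

    -- `u m` and `v n` play 1/(q;q)_m and 1/(q²;q²)_n, known only through their initial values and
    -- one-step relations.
    term : ℕ → ℕ → ℕ → ℕ → Carrier
    term a b m n = sgn n * (q ^ e a b m n * (u m * v n))

    G : ℕ → ℕ → Carrier
    G a b = Σ K (λ m → Σ K (term a b m))

    term-cong-exponent : ∀ a b a′ b′ m n → e a b m n ≡.≡ e a′ b′ m n → term a b m n ≈ term a′ b′ m n
    term-cong-exponent _ _ _ _ m n eq = reflexive (≡.cong (λ x → sgn n * (q ^ x * (u m * v n))) eq)

    term-vanish : ∀ a b m n → K ≤ e a b m n → term a b m n ≈ 0#
    term-vanish a b m n K≤e = *0≈0 _ (0*≈0 _ (^-nilpotent {q} qᴷ≈0 K≤e))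

    q^e-sucˡ : ∀ a b m n → q ^ e a b (suc m) n ≈ q ^ suc a * q ^ e (2 ℕ.+ a) (2 ℕ.+ b) m n
    q^e-sucˡ a b m n = trans (reflexive (≡.cong (q ^_) (e-sucˡ a b m n))) (^-homo-* q (suc a) _)

    q^e-sucʳ : ∀ a b m n → q ^ e a b m (suc n) ≈ q ^ suc b * q ^ e (2 ℕ.+ a) (2 ℕ.+ b) m n
    q^e-sucʳ a b m n = trans (reflexive (≡.cong (q ^_) (e-sucʳ a b m n))) (^-homo-* q (suc b) _)

    q^e-addˡ : ∀ a b m n → q ^ e (suc a) b m n ≈ q ^ e a b m n * q ^ m
    q^e-addˡ a b m n = trans (reflexive (≡.cong (q ^_) (e-addˡ a b m n))) (^-homo-* q (e a b m n) m)

    q^e-addʳ : ∀ a b m n → q ^ e a (2 ℕ.+ b) m n ≈ q ^ e a b m n * (q ^ 2) ^ n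
    q^e-addʳ a b m n = trans (reflexive (≡.cong (q ^_) (e-addʳ a b m n)))
      (trans (^-homo-* q (e a b m n) (2 ℕ.* n)) (*-congˡ (sym (^-assocʳ q 2 n))))

    -- Raising a by 1 multiplies by q to the summation index, so the difference carries exactly the
    -- factor that cancels the last one of (q;q)_(m+1).
    term-stepˡ : ∀ a b m n → term a b (suc m) n - term (suc a) b (suc m) n
                 ≈ q ^ suc a * term (2 ℕ.+ a) (2 ℕ.+ b) m n
    term-stepˡ a b m n = begin
      term a b (suc m) n - term (suc a) b (suc m) n
        ≈⟨ +-congˡ (-‿cong (*-congˡ (*-congʳ (q^e-addˡ a b (suc m) n)))) ⟩
      s * (x * (u (suc m) * v n)) - s * (x * p * (u (suc m) * v n))
        ≈⟨ solve 5 (λ s x p u v → s :* (x :* (u :* v)) :- s :* (x :* p :* (u :* v))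
                    := s :* (x :* (((con (+ 1) :- p) :* u) :* v))) refl _ _ _ _ _ ⟩
      s * (x * (((1# - p) * u (suc m)) * v n))
        ≈⟨ *-congˡ (*-cong (q^e-sucˡ a b m n) (*-congʳ (u-suc m))) ⟩
      s * (q ^ suc a * y * (u m * v n))
        ≈⟨ solve 4 (λ s a y w → s :* (a :* y :* w) := a :* (s :* (y :* w))) refl _ _ _ _ ⟩
      q ^ suc a * term (2 ℕ.+ a) (2 ℕ.+ b) m n ∎
      where
      s = sgn n
      p = q ^ suc m
      x = q ^ e a b (suc m) n
      y = q ^ e (2 ℕ.+ a) (2 ℕ.+ b) m n

    -- The base q² of the second denominator forces a step of 2 in b; the minus sign comes from
    -- (-1)^n.
    term-stepʳ : ∀ a b m n → term a b m (suc n) - term a (2 ℕ.+ b) m (suc n)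
                 ≈ - q ^ suc b * term (2 ℕ.+ a) (2 ℕ.+ b) m n
    term-stepʳ a b m n = begin
      term a b m (suc n) - term a (2 ℕ.+ b) m (suc n)
        ≈⟨ +-congˡ (-‿cong (*-congˡ (*-congʳ (q^e-addʳ a b m (suc n))))) ⟩
      - s * (x * (u m * v (suc n))) - - s * (x * p * (u m * v (suc n)))
        ≈⟨ solve 5 (λ s x p u v → :- s :* (x :* (u :* v)) :- :- s :* (x :* p :* (u :* v))
                    := :- s :* (x :* (u :* ((con (+ 1) :- p) :* v)))) refl _ _ _ _ _ ⟩
      - s * (x * (u m * ((1# - p) * v (suc n))))
        ≈⟨ *-congˡ (*-cong (q^e-sucʳ a b m n) (*-congˡ (v-suc n))) ⟩
      - s * (q ^ suc b * y * (u m * v n))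
        ≈⟨ solve 4 (λ s a y w → :- s :* (a :* y :* w) := :- a :* (s :* (y :* w))) refl _ _ _ _ ⟩
      - q ^ suc b * term (2 ℕ.+ a) (2 ℕ.+ b) m n ∎
      where
      s = sgn n
      p = (q ^ 2) ^ suc n
      x = q ^ e a b m (suc n)
      y = q ^ e (2 ℕ.+ a) (2 ℕ.+ b) m n

    G-stepˡ : ∀ a b → G a b ≈ G (suc a) b + q ^ suc a * G (2 ℕ.+ a) (2 ℕ.+ b)
    G-stepˡ a b = x-y≈z⇒x≈y+z (begin
      G a b - G (suc a) b                   ≈⟨ Σ-sub K _ _ ⟨
      -- At m = 0 the parameter a has no effect, so `D 0` is zero; at m = K both exponents reach K.
      Σ K D                                 ≈⟨ Σ-shift K D D0≈0 DK≈0 ⟩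
      Σ K (D ∘ suc)                         ≈⟨ Σ-cong K D-suc ⟩
      Σ K (λ m → q ^ suc a * Σ K (term (2 ℕ.+ a) (2 ℕ.+ b) m))  ≈⟨ Σ-*ˡ K _ _ ⟩
      q ^ suc a * G (2 ℕ.+ a) (2 ℕ.+ b)     ∎)
      where
      D : ℕ → Carrier
      D m = Σ K (term a b m) - Σ K (term (suc a) b m)
      D0≈0 : D 0 ≈ 0#
      D0≈0 = trans (+-congʳ (Σ-cong K (λ n → term-cong-exponent a b (suc a) b 0 n
        (≡.cong (λ z → n ℕ.* n ℕ.+ z ℕ.+ b ℕ.* n) (≡.trans (ℕ.*-zeroʳ a) (≡.sym (ℕ.*-zeroʳ (suc a)))))))) (-‿inverseʳ _)
      DK≈0 : D K ≈ 0#
      DK≈0 = trans (+-cong (Σ-zero K (λ n → term-vanish a b K n (m≤e a b K n)))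
                           (-‿cong (Σ-zero K (λ n → term-vanish (suc a) b K n (m≤e (suc a) b K n))))) (-‿inverseʳ 0#)
      D-suc : ∀ m → D (suc m) ≈ q ^ suc a * Σ K (term (2 ℕ.+ a) (2 ℕ.+ b) m)
      D-suc m = begin
        D (suc m)                                                      ≈⟨ Σ-sub K _ _ ⟨
        Σ K (λ n → term a b (suc m) n - term (suc a) b (suc m) n)      ≈⟨ Σ-cong K (term-stepˡ a b m) ⟩
        Σ K (λ n → q ^ suc a * term (2 ℕ.+ a) (2 ℕ.+ b) m n)           ≈⟨ Σ-*ˡ K _ _ ⟩
        q ^ suc a * Σ K (term (2 ℕ.+ a) (2 ℕ.+ b) m)                   ∎

    G-stepʳ : ∀ a b → G a b ≈ G a (2 ℕ.+ b) + - q ^ suc b * G (2 ℕ.+ a) (2 ℕ.+ b)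
    G-stepʳ a b = x-y≈z⇒x≈y+z (begin
      G a b - G a (2 ℕ.+ b)                                              ≈⟨ Σ-sub K _ _ ⟨
      Σ K (λ m → Σ K (term a b m) - Σ K (term a (2 ℕ.+ b) m))            ≈⟨ Σ-cong K inner ⟩
      Σ K (λ m → - q ^ suc b * Σ K (term (2 ℕ.+ a) (2 ℕ.+ b) m))         ≈⟨ Σ-*ˡ K _ _ ⟩
      - q ^ suc b * G (2 ℕ.+ a) (2 ℕ.+ b)                                ∎)
      where
      module _ (m : ℕ) where
        D : ℕ → Carrier
        D n = term a b m n - term a (2 ℕ.+ b) m n
        D0≈0 : D 0 ≈ 0#
        D0≈0 = trans (+-congʳ (term-cong-exponent a b a (2 ℕ.+ b) m 0
          (≡.cong ((m ℕ.+ 0) ℕ.* (m ℕ.+ 0) ℕ.+ a ℕ.* m ℕ.+_) (≡.trans (ℕ.*-zeroʳ b) (≡.sym (ℕ.*-zeroʳ (2 ℕ.+ b))))))) (-‿inverseʳ _)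
        DK≈0 : D K ≈ 0#
        DK≈0 = trans (+-cong (term-vanish a b m K (n≤e a b m K))
                             (-‿cong (term-vanish a (2 ℕ.+ b) m K (n≤e a (2 ℕ.+ b) m K)))) (-‿inverseʳ 0#)
        inner : Σ K (term a b m) - Σ K (term a (2 ℕ.+ b) m) ≈ - q ^ suc b * Σ K (term (2 ℕ.+ a) (2 ℕ.+ b) m)
        inner = begin
          Σ K (term a b m) - Σ K (term a (2 ℕ.+ b) m)       ≈⟨ Σ-sub K _ _ ⟨
          Σ K D                                             ≈⟨ Σ-shift K D D0≈0 DK≈0 ⟩
          Σ K (D ∘ suc)                                     ≈⟨ Σ-cong K (term-stepʳ a b m) ⟩
          Σ K (λ n → - q ^ suc b * term (2 ℕ.+ a) (2 ℕ.+ b) m n)  ≈⟨ Σ-*ˡ K _ _ ⟩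
          - q ^ suc b * Σ K (term (2 ℕ.+ a) (2 ℕ.+ b) m)    ∎

    -- The path (a, a), (a + 1, a), (a + 2, a), (a + 2, a + 2) returns to the diagonal. The
    -- off-diagonal remainders `A` and `H` are reached from diagonal values by left steps read
    -- backwards.
    G-recurrence : ∀ a → G a a ≈ (1# + q ^ 2 * q ^ a) * G (2 ℕ.+ a) (2 ℕ.+ a)
      + (q ^ 2 * q ^ a) ^ 2 * G (4 ℕ.+ a) (4 ℕ.+ a) - q ^ 10 * (q ^ a) ^ 3 * G (6 ℕ.+ a) (6 ℕ.+ a)
    G-recurrence a = begin
      G a a                                                       ≈⟨ G-stepˡ a a ⟩
      G (1 ℕ.+ a) a + q ^ (1 ℕ.+ a) * f                           ≈⟨ +-congʳ (G-stepˡ (1 ℕ.+ a) a) ⟩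
      G (2 ℕ.+ a) a + q ^ (2 ℕ.+ a) * A + q ^ (1 ℕ.+ a) * f       ≈⟨ +-congʳ (+-congʳ (G-stepʳ (2 ℕ.+ a) a)) ⟩
      f + - q ^ (1 ℕ.+ a) * H + q ^ (2 ℕ.+ a) * A + q ^ (1 ℕ.+ a) * f
        ≈⟨ +-congʳ (+-cong (+-congˡ (*-congˡ H≈)) (*-congˡ A≈)) ⟩
      f + - q ^ (1 ℕ.+ a) * (f - q ^ (3 ℕ.+ a) * g - q ^ (4 ℕ.+ a) * (g - q ^ (5 ℕ.+ a) * h))
        + q ^ (2 ℕ.+ a) * (f - q ^ (3 ℕ.+ a) * g) + q ^ (1 ℕ.+ a) * f
        -- The terms ± q^(a+1) f and ± q^(2a+5) g cancel; for even a only powers of q² survive.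
        ≈⟨ solve 5 (λ q p f g h →
             let p1 = q :* p ; p2 = q :* p1 ; p3 = q :* p2 ; p4 = q :* p3 ; p5 = q :* p4 in
             f :+ :- p1 :* (f :- p3 :* g :- p4 :* (g :- p5 :* h)) :+ p2 :* (f :- p3 :* g) :+ p1 :* f
             := (con (+ 1) :+ q :^ 2 :* p) :* f :+ (q :^ 2 :* p) :^ 2 :* g :- q :^ 10 :* p :^ 3 :* h)
             refl _ _ _ _ _ ⟩
      (1# + q ^ 2 * q ^ a) * f + (q ^ 2 * q ^ a) ^ 2 * g - q ^ 10 * (q ^ a) ^ 3 * h ∎
      where
      f = G (2 ℕ.+ a) (2 ℕ.+ a)
      g = G (4 ℕ.+ a) (4 ℕ.+ a)
      h = G (6 ℕ.+ a) (6 ℕ.+ a)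
      A = G (3 ℕ.+ a) (2 ℕ.+ a)
      H = G (4 ℕ.+ a) (2 ℕ.+ a)
      A≈ : A ≈ f - q ^ (3 ℕ.+ a) * g
      A≈ = x≈y+z⇒y≈x-z (G-stepˡ (2 ℕ.+ a) (2 ℕ.+ a))
      H≈ : H ≈ f - q ^ (3 ℕ.+ a) * g - q ^ (4 ℕ.+ a) * (g - q ^ (5 ℕ.+ a) * h)
      H≈ = trans (x≈y+z⇒y≈x-z (G-stepˡ (3 ℕ.+ a) (2 ℕ.+ a)))
        (+-cong A≈ (-‿cong (*-congˡ (x≈y+z⇒y≈x-z (G-stepˡ (4 ℕ.+ a) (4 ℕ.+ a))))))

    -- Puts the second sum in terms of diagonal values, in the same combination that gives `T 2 5 0`
    -- from `T 3 4 0` and `T 3 4 2`.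
    G12 : G 1 2 ≈ G 0 0 - (q ^ 2) ^ 2 * G 4 4
    G12 = begin
      G 1 2                                        ≈⟨ x≈y+z⇒y≈x-z (G-stepʳ 1 0) ⟩
      G 1 0 - - q ^ 1 * G 3 2
        ≈⟨ +-cong (x≈y+z⇒y≈x-z (G-stepˡ 0 0)) (-‿cong (*-congˡ (x≈y+z⇒y≈x-z (G-stepˡ 2 2)))) ⟩
      G 0 0 - q ^ 1 * G 2 2 - - q ^ 1 * (G 2 2 - q ^ 3 * G 4 4)
        ≈⟨ solve 4 (λ q f g h → f :- q :^ 1 :* g :- :- q :^ 1 :* (g :- q :^ 3 :* h)
                     := f :- (q :^ 2) :^ 2 :* h) refl _ _ _ _ ⟩
      G 0 0 - (q ^ 2) ^ 2 * G 4 4 ∎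

    -- Every exponent other than that of m = n = 0 is at least a.
    G-limit : ∀ a → K ≤ a → G a a ≈ 1#
    G-limit a K≤a = begin
      G a a              ≈⟨ Σ-first _ 1≤K (λ m → Σ-zero K (λ n → term-vanish a a (suc m) n (K≤eˡ m n))) ⟩
      Σ K (term a a 0)   ≈⟨ Σ-first _ 1≤K (λ n → term-vanish a a 0 (suc n) (K≤eʳ n)) ⟩
      term a a 0 0       ≈⟨ first ⟩
      1#                 ∎
      where
      first : term a a 0 0 ≈ 1#
      first = begin
        1# * (q ^ (a ℕ.* 0 ℕ.+ a ℕ.* 0) * (u 0 * v 0))
          ≈⟨ *-congˡ (*-cong (reflexive (≡.cong (q ^_) (≡.cong₂ ℕ._+_ (ℕ.*-zeroʳ a) (ℕ.*-zeroʳ a)))) (*-cong u-zero v-zero)) ⟩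
        1# * (1# * (1# * 1#))  ≈⟨ solve 0 (con (+ 1) :* (con (+ 1) :* (con (+ 1) :* con (+ 1))) := con (+ 1)) refl ⟩
        1#                     ∎
      K≤eˡ : ∀ m n → K ≤ e a a (suc m) n
      K≤eˡ m n = ℕ.≤-trans K≤a (ℕ.≤-trans (ℕ.m≤m*n a (suc m)) (ℕ.≤-trans (ℕ.m≤n+m _ _) (ℕ.m≤m+n _ (a ℕ.* n))))
      K≤eʳ : ∀ n → K ≤ e a a 0 (suc n)
      K≤eʳ n = ℕ.≤-trans K≤a (ℕ.≤-trans (ℕ.m≤m*n a (suc n)) (ℕ.m≤n+m _ (suc n ℕ.* suc n ℕ.+ a ℕ.* 0)))

-- The Rogers-Selberg type series and their contiguous relations.

module ThetaSide {c ℓ} (R : CommutativeRing c ℓ) where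
  open CommutativeRing R
  open Exponents using (theta-exponent)
  open IntegerSolver R
  open FiniteSums R
  open JacobiTripleProduct R
  open Algebra.Properties.Semiring.Exp semiring using (_^_; ^-homo-*; ^-assocʳ; ^-congˡ)
  open Algebra.Properties.CommutativeSemiring.Exp commutativeSemiring using (^-distrib-*)
  open import Relation.Binary.Reasoning.Setoid setoid

  module Nilpotent
    (Q : Carrier) (K : ℕ) (1≤K : 1 ≤ K) (Qᴷ≈0 : Q ^ K ≈ 0#)
    where

    ^-swap : ∀ x m n → (x ^ m) ^ n ≈ (x ^ n) ^ m
    ^-swap x m n = trans (^-assocʳ x m n)
      (trans (reflexive (≡.cong (x ^_) (ℕ.*-comm m n))) (sym (^-assocʳ x n m)))

    1^n≈1 : ∀ n → 1# ^ n ≈ 1#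
    1^n≈1 zero    = refl
    1^n≈1 (suc n) = trans (*-identityˡ _) (1^n≈1 n)

    B : Carrier
    B = Q ^ 7

    X : ℕ → ℕ → Carrier
    X k n = σ B ((Q ^ k) ^ 3) n

    X-sucʳ : ∀ k n → X k (suc n) ≈ - ((Q ^ k) ^ 3 * (Q ^ n) ^ 7 * X k n)
    X-sucʳ k n = trans (σ-suc B ((Q ^ k) ^ 3) n) (-‿cong (*-congʳ (*-congˡ (^-swap Q 7 n))))

    X-sucˡ : ∀ k n → X (suc k) n ≈ (Q ^ n) ^ 3 * X k n
    X-sucˡ k n = begin
      ((Q * Q ^ k) ^ 3) ^ n * ρ B n              ≈⟨ *-congʳ (^-congˡ n (^-distrib-* Q (Q ^ k) 3)) ⟩
      (Q ^ 3 * (Q ^ k) ^ 3) ^ n * ρ B n          ≈⟨ *-congʳ (^-distrib-* (Q ^ 3) ((Q ^ k) ^ 3) n) ⟩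
      (Q ^ 3) ^ n * ((Q ^ k) ^ 3) ^ n * ρ B n    ≈⟨ *-congʳ (*-congʳ (^-swap Q 3 n)) ⟩
      (Q ^ n) ^ 3 * ((Q ^ k) ^ 3) ^ n * ρ B n    ≈⟨ *-assoc _ _ _ ⟩
      (Q ^ n) ^ 3 * X k n                        ∎

    -- With x = Q^k this is (Q;Q)_∞ / ((Q;Q)_n (xQ^(n+1);Q)_∞), the denominators of J after
    -- normalisation.
    χ : ℕ → ℕ → Carrier
    χ n k = pochhammer (Q ^ suc n) Q k

    -- Both sides are `χ n (suc k)`, with the first or the last factor split off.
    χ-sucˡ : ∀ n k → (1# - Q ^ suc n) * χ (suc n) k ≈ χ n k * (1# - Q ^ suc n * Q ^ k)
    χ-sucˡ n k = begin
      (1# - Q ^ suc n) * pochhammer (Q * Q ^ suc n) Q k     ≈⟨ *-congˡ (pochhammer-cong Q k (*-comm _ _)) ⟩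
      (1# - Q ^ suc n) * pochhammer (Q ^ suc n * Q) Q k     ≈⟨ pochhammer-shift (Q ^ suc n) Q k ⟨
      pochhammer (Q ^ suc n) Q (suc k)                      ≈⟨ pochhammer-suc (Q ^ suc n) Q k ⟩
      χ n k * (1# - Q ^ suc n * Q ^ k)                      ∎

    t : ℕ → ℕ → ℕ → ℕ → Carrier
    t i j k n = X k n * ((Q ^ n) ^ j * (1# - (Q ^ k * (Q ^ n * Q ^ n) * Q) ^ i)) * χ n k

    -- For i + j = 7, T i j k / (Q;Q)_∞ is Andrews' J_{3,i} evaluated at x = Qᵏ.
    T : ℕ → ℕ → ℕ → Carrier
    T i j k = Σ K (t i j k)

    -- The identity makes the sum telescope; it is a hypothesis because the ring solver
    -- can only prove it for literal exponents.
    module _ (i j i′ j′ : ℕ)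
      (identity : ∀ y κ → y ^ suc j * (1# - (κ * (y * y) * Q) ^ suc i) - y ^ suc (suc j) * (1# - (κ * (y * y) * Q) ^ i)
         - (Q * κ) ^ i * (y ^ 3 * (y ^ j′ * (1# - (Q * κ * (y * y) * Q) ^ i′)) * (1# - Q * y * κ))
         ≈ y ^ suc j * (1# - y) + κ ^ 3 * y ^ 7 * (Q * y) ^ suc j * (1# - Q * y * κ)) where

      -- Andrews' relation for J_{3,i+1} - J_{3,i} at x = Q^k; passing from k to k + 1 replaces x by
      -- xQ.
      T-recurrence : ∀ k → T (suc i) (suc j) k ≈ T i (suc (suc j)) k + (Q * Q ^ k) ^ i * T i′ j′ (suc k)
      T-recurrence k = x-y≈z⇒x≈y+z (x-y≈0⇒x≈y (begin
        T₁ - T₂ - a * T₃                            ≈⟨ +-cong (Σ-sub K _ _) (-‿cong (Σ-*ˡ K a _)) ⟨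
        Σ K (λ n → t₁ n - t₂ n) - Σ K (λ n → a * t₃ n)   ≈⟨ Σ-sub K _ _ ⟨
        Σ K (λ n → t₁ n - t₂ n - a * t₃ n)           ≈⟨ Σ-telescope K g step g0≈0 gK≈0 ⟩
        0#                                          ∎))
        where
        t₁ = t (suc i) (suc j) k
        t₂ = t i (suc (suc j)) k
        t₃ = t i′ j′ (suc k)
        T₁ = T (suc i) (suc j) k
        T₂ = T i (suc (suc j)) k
        T₃ = T i′ j′ (suc k)
        a = (Q * Q ^ k) ^ i
        g : ℕ → Carrier
        -- The factor 1 - Q^n gives zero at n = 0 and, in `g (suc n)`, combines with `χ (suc n) k`
        -- by `χ-sucˡ`, so that `X k n * χ n k` is common to the whole identity.
        g n = X k n * (Q ^ n) ^ suc j * ((1# - Q ^ n) * χ n k)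
        step : ∀ n → t₁ n - t₂ n - a * t₃ n ≈ g n - g (suc n)
        step n = begin
          t₁ n - t₂ n - a * (X (suc k) n * A₃ * χ n (suc k))
            ≈⟨ +-congˡ (-‿cong (*-congˡ (*-cong (*-congʳ (X-sucˡ k n)) (pochhammer-suc (Q ^ suc n) Q k)))) ⟩
          x * A₁ * d - x * A₂ * d - a * (y ^ 3 * x * A₃ * (d * r))
            ≈⟨ solve 8 (λ x A₁ A₂ A₃ d a y r → x :* A₁ :* d :- x :* A₂ :* d :- a :* (y :* x :* A₃ :* (d :* r))
                 := x :* d :* (A₁ :- A₂ :- a :* (y :* A₃ :* r))) refl x A₁ A₂ A₃ d a (y ^ 3) r ⟩
          x * d * (A₁ - A₂ - a * (y ^ 3 * A₃ * r))
            ≈⟨ *-congˡ (identity y (Q ^ k)) ⟩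
          x * d * (y ^ suc j * (1# - y) + (Q ^ k) ^ 3 * y ^ 7 * (Q * y) ^ suc j * r)
            ≈⟨ solve 7 (λ x d b l m n r → x :* d :* (b :* l :+ m :* n :* r)
                 := x :* b :* (l :* d) :- (:- (m :* x)) :* n :* (d :* r)) refl
                 x d (y ^ suc j) (1# - y) ((Q ^ k) ^ 3 * y ^ 7) ((Q * y) ^ suc j) r ⟩
          g n - (- ((Q ^ k) ^ 3 * y ^ 7 * x)) * (Q * y) ^ suc j * (d * r)
            ≈⟨ +-congˡ (-‿cong (*-cong (*-congʳ (X-sucʳ k n)) (χ-sucˡ n k))) ⟨
          g n - g (suc n) ∎
          where
          x = X k n
          y = Q ^ n
          d = χ n k
          r = 1# - Q ^ suc n * Q ^ k
          A₁ = y ^ suc j * (1# - (Q ^ k * (y * y) * Q) ^ suc i)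
          A₂ = y ^ suc (suc j) * (1# - (Q ^ k * (y * y) * Q) ^ i)
          A₃ = y ^ j′ * (1# - (Q ^ suc k * (y * y) * Q) ^ i′)
        g0≈0 : g 0 ≈ 0#
        g0≈0 = *0≈0 _ (0*≈0 _ (-‿inverseʳ 1#))
        gK≈0 : g K ≈ 0#
        gK≈0 = 0*≈0 _ (*0≈0 _ (0*≈0 _ Qᴷ≈0))

    -- The hypothesis `identity` as solver syntax. It holds for i + j = 5, i′ = 3 - i and j′ = 4 +
    -- i, the pattern of the three instances below.
    identityₚ : ∀ {n} → ℕ → ℕ → ℕ → ℕ → (_ _ _ : Polynomial n) → Polynomial n × Polynomial n
    identityₚ i j i′ j′ Q y κ =
         y :^ suc j :* (one :- (κ :* (y :* y) :* Q) :^ suc i) :- y :^ suc (suc j) :* (one :- (κ :* (y :* y) :* Q) :^ i)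
         :- (Q :* κ) :^ i :* (y :^ 3 :* (y :^ j′ :* (one :- (Q :* κ :* (y :* y) :* Q) :^ i′)) :* (one :- Q :* y :* κ))
         := y :^ suc j :* (one :- y) :+ κ :^ 3 :* y :^ 7 :* (Q :* y) :^ suc j :* (one :- Q :* y :* κ)
      where one = con (+ 1)

    T₀≈0 : ∀ j k → T 0 j k ≈ 0#
    T₀≈0 j k = Σ-zero K (λ n → 0*≈0 _ (*0≈0 _ (*0≈0 _ (-‿inverseʳ 1#))))

    T₁-recurrence : ∀ k → T 1 6 k ≈ T 3 4 (suc k)
    T₁-recurrence k = begin
      T 1 6 k                          ≈⟨ T-recurrence 0 5 3 4 (λ y κ → solve 3 (identityₚ 0 5 3 4) refl Q y κ) k ⟩
      T 0 7 k + 1# * T 3 4 (suc k)     ≈⟨ +-cong (T₀≈0 7 k) (*-identityˡ _) ⟩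
      0# + T 3 4 (suc k)               ≈⟨ +-identityˡ _ ⟩
      T 3 4 (suc k)                    ∎

    T₂-recurrence : ∀ k → T 2 5 k ≈ T 1 6 k + Q * Q ^ k * T 2 5 (suc k)
    T₂-recurrence k = trans (T-recurrence 1 4 2 5 (λ y κ → solve 3 (identityₚ 1 4 2 5) refl Q y κ) k)
      (+-congˡ (*-congʳ (*-identityʳ _)))

    T₃-recurrence : ∀ k → T 3 4 k ≈ T 2 5 k + (Q * Q ^ k) ^ 2 * T 1 6 (suc k)
    T₃-recurrence = T-recurrence 2 3 1 6 (λ y κ → solve 3 (identityₚ 2 3 1 6) refl Q y κ)

    T₂≈ : ∀ k → T 2 5 k ≈ T 3 4 k - (Q * Q ^ k) ^ 2 * T 3 4 (2 ℕ.+ k)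
    T₂≈ k = trans (x≈y+z⇒y≈x-z (T₃-recurrence k)) (+-congˡ (-‿cong (*-congˡ (T₁-recurrence (suc k)))))

    -- Elimination of `T 1 6` and `T 2 5`; the coefficients are those of `G-recurrence` at a = 2k,
    -- where q^a is Q^k.
    T₃-recurrence′ : ∀ k → T 3 4 k ≈ (1# + Q * Q ^ k) * T 3 4 (1 ℕ.+ k)
      + (Q * Q ^ k) ^ 2 * T 3 4 (2 ℕ.+ k) - Q ^ 5 * (Q ^ k) ^ 3 * T 3 4 (3 ℕ.+ k)
    T₃-recurrence′ k = begin
      T 3 4 k
        ≈⟨ T₃-recurrence k ⟩
      T 2 5 k + (Q * Q ^ k) ^ 2 * T 1 6 (suc k)
        ≈⟨ +-cong (T₂-recurrence k) (*-congˡ (T₁-recurrence (suc k))) ⟩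
      T 1 6 k + Q * Q ^ k * T 2 5 (suc k) + (Q * Q ^ k) ^ 2 * g
        ≈⟨ +-congʳ (+-cong (T₁-recurrence k) (*-congˡ (T₂≈ (suc k)))) ⟩
      f + Q * Q ^ k * (f - (Q * (Q * Q ^ k)) ^ 2 * h) + (Q * Q ^ k) ^ 2 * g
        ≈⟨ solve 5 (λ Q κ f g h →
             f :+ Q :* κ :* (f :- (Q :* (Q :* κ)) :^ 2 :* h) :+ (Q :* κ) :^ 2 :* g
             := (con (+ 1) :+ Q :* κ) :* f :+ (Q :* κ) :^ 2 :* g :- Q :^ 5 :* κ :^ 3 :* h) refl _ _ _ _ _ ⟩
      (1# + Q * Q ^ k) * f + (Q * Q ^ k) ^ 2 * g - Q ^ 5 * (Q ^ k) ^ 3 * h ∎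
      where
      f = T 3 4 (1 ℕ.+ k)
      g = T 3 4 (2 ℕ.+ k)
      h = T 3 4 (3 ℕ.+ k)

    T-limit : ∀ k → K ≤ k → T 3 4 k ≈ pochhammer Q Q K
    T-limit k K≤k = begin
      -- For n ≥ 1 the factor `X k n` contains Q^k, which is zero here.
      T 3 4 k       ≈⟨ Σ-first _ 1≤K (λ n → 0*≈0 _ (0*≈0 _ (0*≈0 _ (0*≈0 _ (0*≈0 _ κ≈0))))) ⟩
      1# * 1# * (1# ^ 4 * (1# - (Q ^ k * (1# * 1#) * Q) ^ 3)) * χ 0 k
        ≈⟨ *-congʳ (*-congˡ (*-congˡ (+-congˡ (-‿cong (0*≈0 _ (0*≈0 _ (0*≈0 _ κ≈0))))))) ⟩
      1# * 1# * (1# ^ 4 * (1# - 0#)) * χ 0 k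
        ≈⟨ solve 1 (λ p → one :* one :* (one :^ 4 :* (one :- con (+ 0))) :* p := p) refl _ ⟩
      χ 0 k                  ≈⟨ pochhammer-cong Q k (*-identityʳ Q) ⟩
      pochhammer Q Q k       ≈⟨ pochhammer-stable Q Qᴷ≈0 K≤k ⟩
      pochhammer Q Q K       ∎
      where
      one : ∀ {n} → Polynomial n
      one = con (+ 1)
      κ≈0 : Q ^ k ≈ 0#
      κ≈0 = ^-nilpotent {Q} Qᴷ≈0 K≤k

    module _ (i j : ℕ) .{{_ : ℕ.NonZero i}} .{{_ : ℕ.NonZero j}} (i+j≡7 : i ℕ.+ j ≡.≡ 7) where

      t₀-exponent : ∀ n → n ℕ.* j ℕ.+ (n ℕ.+ n ℕ.+ 1) ℕ.* i ≡.≡ i ℕ.* suc n ℕ.+ 7 ℕ.* n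
      t₀-exponent n = ≡.trans (theta-exponent i j n) (≡.cong (λ s → i ℕ.* suc n ℕ.+ s ℕ.* n) i+j≡7)

      t₀-power : ∀ n → (Q ^ n) ^ j * (1# * (Q ^ n * Q ^ n) * Q) ^ i ≈ (Q ^ i) ^ suc n * B ^ n
      t₀-power n = begin
        (Q ^ n) ^ j * (1# * (Q ^ n * Q ^ n) * Q) ^ i        ≈⟨ *-congˡ (^-congˡ i base) ⟩
        (Q ^ n) ^ j * (Q ^ (n ℕ.+ n ℕ.+ 1)) ^ i             ≈⟨ *-cong (^-assocʳ Q n j) (^-assocʳ Q (n ℕ.+ n ℕ.+ 1) i) ⟩
        Q ^ (n ℕ.* j) * Q ^ ((n ℕ.+ n ℕ.+ 1) ℕ.* i)         ≈⟨ ^-homo-* Q (n ℕ.* j) _ ⟨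
        Q ^ (n ℕ.* j ℕ.+ (n ℕ.+ n ℕ.+ 1) ℕ.* i)             ≡⟨ ≡.cong (Q ^_) (t₀-exponent n) ⟩
        Q ^ (i ℕ.* suc n ℕ.+ 7 ℕ.* n)                       ≈⟨ ^-homo-* Q (i ℕ.* suc n) (7 ℕ.* n) ⟩
        Q ^ (i ℕ.* suc n) * Q ^ (7 ℕ.* n)                   ≈⟨ *-cong (^-assocʳ Q i (suc n)) (^-assocʳ Q 7 n) ⟨
        (Q ^ i) ^ suc n * B ^ n                             ∎
        where
        base : 1# * (Q ^ n * Q ^ n) * Q ≈ Q ^ (n ℕ.+ n ℕ.+ 1)
        base = begin
          1# * (Q ^ n * Q ^ n) * Q      ≈⟨ *-cong (*-identityˡ _) (sym (*-identityʳ Q)) ⟩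
          Q ^ n * Q ^ n * Q ^ 1         ≈⟨ *-congʳ (^-homo-* Q n n) ⟨
          Q ^ (n ℕ.+ n) * Q ^ 1         ≈⟨ ^-homo-* Q (n ℕ.+ n) 1 ⟨
          Q ^ (n ℕ.+ n ℕ.+ 1)           ∎

      -- At k = 0 the two parts of 1 - Q^((2n+1)i) become the theta terms of index n and -(n + 1),
      -- with z = Q^j and w = Q^i; zw = B because i + j = 7.
      t₀≈ : ∀ n → t i j 0 n ≈ σ B (Q ^ j) n + σ B (Q ^ i) (suc n)
      t₀≈ n = begin
        (1# ^ 3) ^ n * r * (y * (1# - w)) * 1#
          ≈⟨ *-congʳ (*-congʳ (*-congʳ (trans (^-assocʳ 1# 3 n) (1^n≈1 (3 ℕ.* n))))) ⟩
        1# * r * (y * (1# - w)) * 1#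
          ≈⟨ solve 3 (λ r y w → con (+ 1) :* r :* (y :* (con (+ 1) :- w)) :* con (+ 1) := y :* r :- (y :* w) :* r) refl r y w ⟩
        y * r - (y * w) * r
          ≈⟨ +-cong (*-congʳ (^-swap Q n j)) (-‿cong (*-congʳ (t₀-power n))) ⟩
        (Q ^ j) ^ n * r - ((Q ^ i) ^ suc n * B ^ n) * r
          ≈⟨ +-congˡ (solve 3 (λ z b r → :- ((z :* b) :* r) := z :* (:- (b :* r))) refl _ _ _) ⟩
        σ B (Q ^ j) n + σ B (Q ^ i) (suc n) ∎
        where
        r = ρ B n
        y = (Q ^ n) ^ j
        w = (1# * (Q ^ n * Q ^ n) * Q) ^ i

      T-at-0 : T i j 0 ≈ pochhammer B B K * (pochhammer (Q ^ j) B K * pochhammer (Q ^ i) B K)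
      T-at-0 = trans (Σ-cong K t₀≈)
        (jacobi B K (^^-nilpotent {Q} {K} 7 Qᴷ≈0) (Q ^ j) (Q ^ i) zw≈B
          (^^-nilpotent {Q} {K} j Qᴷ≈0) (^^-nilpotent {Q} {K} i Qᴷ≈0))
        where
        zw≈B : Q ^ j * Q ^ i ≈ B
        zw≈B = trans (sym (^-homo-* Q j i)) (reflexive (≡.cong (Q ^_) (≡.trans (ℕ.+-comm j i) i+j≡7)))

    -- Sorts the factors 1 - Q^m by m modulo 7; each step of the induction adds one factor to every
    -- class.
    dissect : ∀ n → pochhammer Q Q (n ℕ.* 7) ≈
      pochhammer (Q ^ 1) B n * pochhammer (Q ^ 2) B n * pochhammer (Q ^ 3) B n * pochhammer (Q ^ 4) B n
      * pochhammer (Q ^ 5) B n * pochhammer (Q ^ 6) B n * pochhammer B B n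
    dissect zero = solve 0 (one := one :* one :* one :* one :* one :* one :* one) refl
      where
      one : Polynomial 0
      one = con (+ 1)
    dissect (suc n) = begin
      pochhammer Q Q (7 ℕ.+ n ℕ.* 7)
        ≈⟨ step 6 (step 5 (step 4 (step 3 (step 2 (step 1 (step 0 (dissect n))))))) ⟩
      p 1 * p 2 * p 3 * p 4 * p 5 * p 6 * p 7 * r 0 * r 1 * r 2 * r 3 * r 4 * r 5 * r 6
        ≈⟨ solve 14 (λ p₁ p₂ p₃ p₄ p₅ p₆ p₇ r₁ r₂ r₃ r₄ r₅ r₆ r₇ →
             p₁ :* p₂ :* p₃ :* p₄ :* p₅ :* p₆ :* p₇ :* r₁ :* r₂ :* r₃ :* r₄ :* r₅ :* r₆ :* r₇
             := (p₁ :* r₁) :* (p₂ :* r₂) :* (p₃ :* r₃) :* (p₄ :* r₄) :* (p₅ :* r₅) :* (p₆ :* r₆) :* (p₇ :* r₇))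
             refl _ _ _ _ _ _ _ _ _ _ _ _ _ _ ⟩
      (p 1 * r 0) * (p 2 * r 1) * (p 3 * r 2) * (p 4 * r 3) * (p 5 * r 4) * (p 6 * r 5) * (p 7 * r 6)
        ≈⟨ *-cong (*-cong (*-cong (*-cong (*-cong (*-cong (s 1) (s 2)) (s 3)) (s 4)) (s 5)) (s 6)) (s 7) ⟨
      p′ 1 * p′ 2 * p′ 3 * p′ 4 * p′ 5 * p′ 6 * p′ 7 ∎
      where
      p p′ r : ℕ → Carrier
      p i = pochhammer (Q ^ i) B n
      p′ i = pochhammer (Q ^ i) B (suc n)
      r i = 1# - Q ^ suc i * B ^ n
      s : ∀ i → p′ i ≈ p i * (1# - Q ^ i * B ^ n)
      s i = pochhammer-suc (Q ^ i) B n
      step : ∀ i {x} → pochhammer Q Q (i ℕ.+ n ℕ.* 7) ≈ x → pochhammer Q Q (suc i ℕ.+ n ℕ.* 7) ≈ x * r i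
      step i {x} eq = begin
        pochhammer Q Q (suc i ℕ.+ n ℕ.* 7)
          ≈⟨ pochhammer-suc Q Q (i ℕ.+ n ℕ.* 7) ⟩
        pochhammer Q Q (i ℕ.+ n ℕ.* 7) * (1# - Q ^ (suc i ℕ.+ n ℕ.* 7))
          ≈⟨ *-cong eq (+-congˡ (-‿cong (trans (^-homo-* Q (suc i) (n ℕ.* 7)) (*-congˡ Qⁿ⁷)))) ⟩
        x * r i ∎
        where
        Qⁿ⁷ : Q ^ (n ℕ.* 7) ≈ B ^ n
        Qⁿ⁷ = trans (reflexive (≡.cong (Q ^_) (ℕ.*-comm n 7))) (sym (^-assocʳ Q 7 n))

-- Comparison of the two sides and the three product evaluations.

module RogersSelberg {c ℓ} (R : CommutativeRing c ℓ) where
  open CommutativeRing R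
  open IntegerSolver R
  open FiniteSums R
  open Algebra.Properties.Semiring.Exp semiring using (_^_; ^-assocʳ; ^-congˡ)
  open import Relation.Binary.Reasoning.Setoid setoid

  module WithInverses
    (q : Carrier) (K : ℕ) (1≤K : 1 ≤ K) (qᴷ≈0 : q ^ K ≈ 0#)
    (u v : ℕ → Carrier) (u-zero : u 0 ≈ 1#) (v-zero : v 0 ≈ 1#)
    (u-suc : ∀ m → (1# - q ^ suc m) * u (suc m) ≈ u m)
    (v-suc : ∀ n → (1# - (q ^ 2) ^ suc n) * v (suc n) ≈ v n)
    where

    open DoubleSum.WithInverses R q K 1≤K qᴷ≈0 u v u-zero v-zero u-suc v-suc public
    open ThetaSide.Nilpotent R (q ^ 2) K 1≤K (^^-nilpotent {q} {K} 2 qᴷ≈0)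

    Q φ : Carrier
    Q = q ^ 2
    φ = pochhammer Q Q K

    F : ℕ → Carrier
    F k = G (k ℕ.* 2) (k ℕ.* 2)

    F-recurrence : ∀ k → F k ≈ (1# + Q * Q ^ k) * F (1 ℕ.+ k)
      + (Q * Q ^ k) ^ 2 * F (2 ℕ.+ k) - Q ^ 5 * (Q ^ k) ^ 3 * F (3 ℕ.+ k)
    F-recurrence k = trans (G-recurrence (k ℕ.* 2))
      (+-cong (+-cong (*-congʳ (+-congˡ (*-congˡ q²ᵏ≈))) (*-congʳ (^-congˡ 2 (*-congˡ q²ᵏ≈))))
              (-‿cong (*-congʳ (*-cong (sym (^-assocʳ q 2 5)) (^-congˡ 3 q²ᵏ≈)))))
      where
      q²ᵏ≈ : q ^ (k ℕ.* 2) ≈ Q ^ k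
      q²ᵏ≈ = trans (reflexive (≡.cong (q ^_) (ℕ.*-comm k 2))) (sym (^-assocʳ q 2 k))

    -- Both sides satisfy the same recurrence in k and agree once Qᵏ ≈ 0.
    φF≈T-from : ∀ d k → K ≤ d ℕ.+ k → φ * F k ≈ T 3 4 k
    φF≈T-from zero k K≤k = begin
      φ * F k      ≈⟨ *-congˡ (G-limit (k ℕ.* 2) (ℕ.≤-trans K≤k (ℕ.m≤m*n k 2))) ⟩
      φ * 1#       ≈⟨ *-identityʳ φ ⟩
      φ            ≈⟨ T-limit k K≤k ⟨
      T 3 4 k      ∎
    φF≈T-from (suc d) k K≤1+d+k = begin
      φ * F k
        ≈⟨ *-congˡ (F-recurrence k) ⟩
      φ * (a * F (1 ℕ.+ k) + b * F (2 ℕ.+ k) - e′ * F (3 ℕ.+ k))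
        ≈⟨ solve 7 (λ φ a b e f g h → φ :* (a :* f :+ b :* g :- e :* h)
                     := a :* (φ :* f) :+ b :* (φ :* g) :- e :* (φ :* h)) refl _ _ _ _ _ _ _ ⟩
      a * (φ * F (1 ℕ.+ k)) + b * (φ * F (2 ℕ.+ k)) - e′ * (φ * F (3 ℕ.+ k))
        ≈⟨ +-cong (+-cong (*-congˡ (φF≈T-from d (1 ℕ.+ k) K≤₁)) (*-congˡ (φF≈T-from d (2 ℕ.+ k) K≤₂)))
                  (-‿cong (*-congˡ (φF≈T-from d (3 ℕ.+ k) K≤₃))) ⟩
      a * T 3 4 (1 ℕ.+ k) + b * T 3 4 (2 ℕ.+ k) - e′ * T 3 4 (3 ℕ.+ k)
        ≈⟨ T₃-recurrence′ k ⟨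
      T 3 4 k ∎
      where
      a = 1# + Q * Q ^ k
      b = (Q * Q ^ k) ^ 2
      e′ = Q ^ 5 * (Q ^ k) ^ 3
      -- Only d decreases; the calls at k + 2 and k + 3 meet the same bound with room to spare.
      K≤₁ : K ≤ d ℕ.+ (1 ℕ.+ k)
      K≤₁ = ≡.subst (K ≤_) (≡.sym (ℕ.+-suc d k)) K≤1+d+k
      K≤₂ : K ≤ d ℕ.+ (2 ℕ.+ k)
      K≤₂ = ℕ.≤-trans K≤₁ (ℕ.+-monoʳ-≤ d (ℕ.n≤1+n (1 ℕ.+ k)))
      K≤₃ : K ≤ d ℕ.+ (3 ℕ.+ k)
      K≤₃ = ℕ.≤-trans K≤₂ (ℕ.+-monoʳ-≤ d (ℕ.n≤1+n (2 ℕ.+ k)))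

    φF≈T : ∀ k → φ * F k ≈ T 3 4 k
    φF≈T k = φF≈T-from K k (ℕ.m≤m+n K k)

    φv≈1 : ∀ n → pochhammer Q Q n * v n ≈ 1#
    φv≈1 zero    = trans (*-identityˡ _) v-zero
    φv≈1 (suc n) = begin
      pochhammer Q Q (suc n) * v (suc n)                    ≈⟨ *-congʳ (pochhammer-suc Q Q n) ⟩
      pochhammer Q Q n * (1# - Q ^ suc n) * v (suc n)       ≈⟨ *-assoc _ _ _ ⟩
      pochhammer Q Q n * ((1# - Q ^ suc n) * v (suc n))     ≈⟨ *-congˡ (v-suc n) ⟩
      pochhammer Q Q n * v n                                ≈⟨ φv≈1 n ⟩
      1#                                                    ∎

    -- φ is a unit with inverse `v K`, so the theta product t cancels although no inverse of t is at
    -- hand.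
    cancel-φ : ∀ {t P f} → φ ≈ t * P → φ * f ≈ t → P * f ≈ 1#
    cancel-φ {t} {P} {f} φ≈tP φf≈t = begin
      P * f                     ≈⟨ *-identityʳ _ ⟨
      P * f * 1#                ≈⟨ *-congˡ (φv≈1 K) ⟨
      P * f * (φ * v K)         ≈⟨ solve 4 (λ P f φ v → P :* f :* (φ :* v) := φ :* f :* P :* v) refl _ _ _ _ ⟩
      φ * f * P * v K           ≈⟨ *-congʳ (*-congʳ φf≈t) ⟩
      t * P * v K               ≈⟨ *-congʳ φ≈tP ⟨
      φ * v K                   ≈⟨ φv≈1 K ⟩
      1#                        ∎

    p : ℕ → Carrier
    p r = pochhammer (Q ^ r) (Q ^ 7) K

    φ-dissect : φ ≈ p 1 * p 2 * p 3 * p 4 * p 5 * p 6 * p 7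
    -- Lengthening the product to 7K factors costs nothing and leaves K of them in each residue
    -- class.
    φ-dissect = trans (sym (pochhammer-stable Q {Q} {K} {K ℕ.* 7} (^^-nilpotent {q} {K} 2 qᴷ≈0) (ℕ.m≤m*n K 7))) (dissect K)

    identity₁ : p 1 * (p 2 * (p 5 * p 6)) * G 0 0 ≈ 1#
    identity₁ = cancel-φ
      (trans φ-dissect (solve 7 (λ p₁ p₂ p₃ p₄ p₅ p₆ p₇ → p₁ :* p₂ :* p₃ :* p₄ :* p₅ :* p₆ :* p₇
        := p₇ :* (p₄ :* p₃) :* (p₁ :* (p₂ :* (p₅ :* p₆)))) refl _ _ _ _ _ _ _))
      (trans (φF≈T 0) (T-at-0 3 4 ≡.refl))

    identity₂ : p 1 * (p 3 * (p 4 * p 6)) * G 1 2 ≈ 1#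
    identity₂ = cancel-φ
      (trans φ-dissect (solve 7 (λ p₁ p₂ p₃ p₄ p₅ p₆ p₇ → p₁ :* p₂ :* p₃ :* p₄ :* p₅ :* p₆ :* p₇
        := p₇ :* (p₅ :* p₂) :* (p₁ :* (p₃ :* (p₄ :* p₆)))) refl _ _ _ _ _ _ _))
      (begin
        φ * G 1 2                                ≈⟨ *-congˡ G12 ⟩
        φ * (G 0 0 - Q ^ 2 * G 4 4)
          -- The factor 1 is Q^0, kept so that the expression matches `T₂≈ 0`.
          ≈⟨ solve 4 (λ φ f Q g → φ :* (f :- Q :^ 2 :* g) := φ :* f :- (Q :* con (+ 1)) :^ 2 :* (φ :* g)) refl _ _ _ _ ⟩
        φ * F 0 - (Q * 1#) ^ 2 * (φ * F 2)       ≈⟨ +-cong (φF≈T 0) (-‿cong (*-congˡ (φF≈T 2))) ⟩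
        T 3 4 0 - (Q * 1#) ^ 2 * T 3 4 2         ≈⟨ T₂≈ 0 ⟨
        T 2 5 0                                  ≈⟨ T-at-0 2 5 ≡.refl ⟩
        p 7 * (p 5 * p 2)                        ∎)

    -- `G 2 2` is `F 1`, and `T 3 4 1` is `T 1 6 0`; this brings k back to 0, where the triple
    -- product applies.
    identity₃ : p 2 * (p 3 * (p 4 * p 5)) * G 2 2 ≈ 1#
    identity₃ = cancel-φ
      (trans φ-dissect (solve 7 (λ p₁ p₂ p₃ p₄ p₅ p₆ p₇ → p₁ :* p₂ :* p₃ :* p₄ :* p₅ :* p₆ :* p₇
        := p₇ :* (p₆ :* p₁) :* (p₂ :* (p₃ :* (p₄ :* p₅)))) refl _ _ _ _ _ _ _))
      (trans (φF≈T 1) (trans (sym (T₁-recurrence 0)) (T-at-0 1 6 ≡.refl)))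

-- The ring of integer power series and its truncations.

module PowerSeries where
  open import Data.Integer using (_+_; _*_; -_; _-_)
  open import Data.Integer.Properties
  open ≡ using (refl; sym; trans; cong; cong₂)
  open ≡.≡-Reasoning
  open Data.Integer.Solver.+-*-Solver using (solve; _:+_; _:*_; :-_; _:=_; con)

  shift : FPS → FPS
  shift f n = f (suc n)

  *ₚ-0 : ∀ f g → (f *ₚ g) 0 ≡ f 0 * g 0
  *ₚ-0 f g = +-identityʳ _

  -- Reads f as f(0) + q `shift f`. It replaces the list definition of the product by a recursion on
  -- the coefficient index, on which the ring laws rest.
  *ₚ-suc : ∀ f g n → (f *ₚ g) (suc n) ≡ f 0 * g (suc n) + (shift f *ₚ g) n
  *ₚ-suc f g n = cong (λ l → f 0 * g (suc n) + sumℤ l)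
    (trans (List.map-applyUpTo suc (λ i → f i * g (suc n ℕ.∸ i)) (suc n))
           (sym (List.map-upTo (λ i → f (suc i) * g (n ℕ.∸ i)) (suc n))))

  -- This is what makes multiplication well defined modulo a power of q.
  *ₚ-cong-≤ : ∀ n {f f′ g g′} → (∀ i → i ≤ n → f i ≡ f′ i) → (∀ i → i ≤ n → g i ≡ g′ i) →
              (f *ₚ g) n ≡ (f′ *ₚ g′) n
  *ₚ-cong-≤ zero    f≡ g≡ = cong₂ (λ a b → a * b + + 0) (f≡ 0 z≤n) (g≡ 0 z≤n)
  *ₚ-cong-≤ (suc n) {f} {f′} {g} {g′} f≡ g≡ = begin
    (f *ₚ g) (suc n)                            ≡⟨ *ₚ-suc f g n ⟩
    f 0 * g (suc n) + (shift f *ₚ g) n          ≡⟨ cong₂ _+_ (cong₂ _*_ (f≡ 0 z≤n) (g≡ (suc n) ℕ.≤-refl))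
      (*ₚ-cong-≤ n (λ i i≤n → f≡ (suc i) (s≤s i≤n)) (λ i i≤n → g≡ i (ℕ.m≤n⇒m≤1+n i≤n))) ⟩
    f′ 0 * g′ (suc n) + (shift f′ *ₚ g′) n      ≡⟨ *ₚ-suc f′ g′ n ⟨
    (f′ *ₚ g′) (suc n)                          ∎

  *ₚ-congʳ : ∀ {f f′} g → f ≗ f′ → f *ₚ g ≗ f′ *ₚ g
  *ₚ-congʳ g f≗ n = *ₚ-cong-≤ n {g = g} (λ i _ → f≗ i) (λ _ _ → refl)

  *ₚ-sucʳ : ∀ f g n → (f *ₚ g) (suc n) ≡ f (suc n) * g 0 + (f *ₚ shift g) n
  *ₚ-sucʳ f g zero = begin
    (f *ₚ g) 1                             ≡⟨ *ₚ-suc f g 0 ⟩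
    f 0 * g 1 + (shift f *ₚ g) 0           ≡⟨ solve 4 (λ a b c d → a :* b :+ (c :* d :+ con (+ 0)) := c :* d :+ (a :* b :+ con (+ 0))) refl (f 0) (g 1) (f 1) (g 0) ⟩
    f 1 * g 0 + (f *ₚ shift g) 0           ∎
  *ₚ-sucʳ f g (suc n) = begin
    (f *ₚ g) (suc (suc n))                                                    ≡⟨ *ₚ-suc f g (suc n) ⟩
    f 0 * g (suc (suc n)) + (shift f *ₚ g) (suc n)                            ≡⟨ cong (λ x → f 0 * g (suc (suc n)) + x) (*ₚ-sucʳ (shift f) g n) ⟩
    f 0 * g (suc (suc n)) + (f (suc (suc n)) * g 0 + (shift f *ₚ shift g) n)  ≡⟨ +-assoc-swap (f 0 * g (suc (suc n))) (f (suc (suc n)) * g 0) _ ⟩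
    f (suc (suc n)) * g 0 + (f 0 * g (suc (suc n)) + (shift f *ₚ shift g) n)  ≡⟨ cong (λ x → f (suc (suc n)) * g 0 + x) (*ₚ-suc f (shift g) n) ⟨
    f (suc (suc n)) * g 0 + (f *ₚ shift g) (suc n)                            ∎
    where
    +-assoc-swap : ∀ a b c → a + (b + c) ≡ b + (a + c)
    +-assoc-swap = solve 3 (λ a b c → a :+ (b :+ c) := b :+ (a :+ c)) refl

  *ₚ-comm : ∀ f g → f *ₚ g ≗ g *ₚ f
  *ₚ-comm f g zero    = cong (λ x → x + + 0) (*-comm (f 0) (g 0))
  *ₚ-comm f g (suc n) = begin
    (f *ₚ g) (suc n)                       ≡⟨ *ₚ-suc f g n ⟩
    f 0 * g (suc n) + (shift f *ₚ g) n     ≡⟨ cong₂ _+_ (*-comm (f 0) (g (suc n))) (*ₚ-comm (shift f) g n) ⟩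
    g (suc n) * f 0 + (g *ₚ shift f) n     ≡⟨ *ₚ-sucʳ g f n ⟨
    (g *ₚ f) (suc n)                       ∎

  *ₚ-distribʳ : ∀ h f g → (f +ₚ g) *ₚ h ≗ (f *ₚ h) +ₚ (g *ₚ h)
  *ₚ-distribʳ h f g zero    = solve 3 (λ f g h → (f :+ g) :* h :+ con (+ 0) := (f :* h :+ con (+ 0)) :+ (g :* h :+ con (+ 0))) refl (f 0) (g 0) (h 0)
  *ₚ-distribʳ h f g (suc n) = begin
    ((f +ₚ g) *ₚ h) (suc n)                                    ≡⟨ *ₚ-suc (f +ₚ g) h n ⟩
    (f 0 + g 0) * h (suc n) + ((shift f +ₚ shift g) *ₚ h) n    ≡⟨ cong (λ x → (f 0 + g 0) * h (suc n) + x) (*ₚ-distribʳ h (shift f) (shift g) n) ⟩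
    (f 0 + g 0) * h (suc n) + ((shift f *ₚ h) n + (shift g *ₚ h) n)
      ≡⟨ solve 5 (λ f g h a b → (f :+ g) :* h :+ (a :+ b) := (f :* h :+ a) :+ (g :* h :+ b)) refl (f 0) (g 0) (h (suc n)) _ _ ⟩
    (f 0 * h (suc n) + (shift f *ₚ h) n) + (g 0 * h (suc n) + (shift g *ₚ h) n)
      ≡⟨ cong₂ _+_ (*ₚ-suc f h n) (*ₚ-suc g h n) ⟨
    (f *ₚ h) (suc n) + (g *ₚ h) (suc n) ∎

  scale-*ₚ : ∀ c f g → scale c f *ₚ g ≗ scale c (f *ₚ g)
  scale-*ₚ c f g zero    = solve 3 (λ c f g → c :* f :* g :+ con (+ 0) := c :* (f :* g :+ con (+ 0))) refl c (f 0) (g 0)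
  scale-*ₚ c f g (suc n) = begin
    (scale c f *ₚ g) (suc n)                               ≡⟨ *ₚ-suc (scale c f) g n ⟩
    c * f 0 * g (suc n) + (scale c (shift f) *ₚ g) n       ≡⟨ cong (λ x → c * f 0 * g (suc n) + x) (scale-*ₚ c (shift f) g n) ⟩
    c * f 0 * g (suc n) + c * (shift f *ₚ g) n             ≡⟨ solve 4 (λ c f g a → c :* f :* g :+ c :* a := c :* (f :* g :+ a)) refl c (f 0) (g (suc n)) _ ⟩
    c * (f 0 * g (suc n) + (shift f *ₚ g) n)               ≡⟨ cong (c *_) (*ₚ-suc f g n) ⟨
    scale c (f *ₚ g) (suc n)                               ∎

  *ₚ-assoc : ∀ f g h → (f *ₚ g) *ₚ h ≗ f *ₚ (g *ₚ h)
  *ₚ-assoc f g h zero    = solve 3 (λ f g h → (f :* g :+ con (+ 0)) :* h :+ con (+ 0) := f :* (g :* h :+ con (+ 0)) :+ con (+ 0)) refl (f 0) (g 0) (h 0)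
  *ₚ-assoc f g h (suc n) = begin
    ((f *ₚ g) *ₚ h) (suc n)
      ≡⟨ *ₚ-suc (f *ₚ g) h n ⟩
    (f *ₚ g) 0 * h (suc n) + (shift (f *ₚ g) *ₚ h) n
      -- `*ₚ-suc` read at all n at once: `shift (f *ₚ g)` is f(0) `shift g` plus `shift f *ₚ g`.
      ≡⟨ cong₂ (λ a b → a * h (suc n) + b) (*ₚ-0 f g) (*ₚ-congʳ h (*ₚ-suc f g) n) ⟩
    f 0 * g 0 * h (suc n) + ((scale (f 0) (shift g) +ₚ (shift f *ₚ g)) *ₚ h) n
      ≡⟨ cong (λ x → f 0 * g 0 * h (suc n) + x) (*ₚ-distribʳ h (scale (f 0) (shift g)) (shift f *ₚ g) n) ⟩
    f 0 * g 0 * h (suc n) + ((scale (f 0) (shift g) *ₚ h) n + ((shift f *ₚ g) *ₚ h) n)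
      ≡⟨ cong (λ x → f 0 * g 0 * h (suc n) + x) (cong₂ _+_ (scale-*ₚ (f 0) (shift g) h n) (*ₚ-assoc (shift f) g h n)) ⟩
    f 0 * g 0 * h (suc n) + (f 0 * (shift g *ₚ h) n + (shift f *ₚ (g *ₚ h)) n)
      ≡⟨ solve 5 (λ f g h a b → f :* g :* h :+ (f :* a :+ b) := f :* (g :* h :+ a) :+ b) refl (f 0) (g 0) (h (suc n)) _ _ ⟩
    f 0 * (g 0 * h (suc n) + (shift g *ₚ h) n) + (shift f *ₚ (g *ₚ h)) n
      ≡⟨ cong (λ a → f 0 * a + (shift f *ₚ (g *ₚ h)) n) (*ₚ-suc g h n) ⟨
    f 0 * (g *ₚ h) (suc n) + (shift f *ₚ (g *ₚ h)) n
      ≡⟨ *ₚ-suc f (g *ₚ h) n ⟨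
    (f *ₚ (g *ₚ h)) (suc n) ∎

  *ₚ-zeroˡ : ∀ f → 0ₚ *ₚ f ≗ 0ₚ
  *ₚ-zeroˡ f zero    = refl
  *ₚ-zeroˡ f (suc n) = trans (*ₚ-suc 0ₚ f n) (trans (+-identityˡ _) (*ₚ-zeroˡ f n))

  *ₚ-identityˡ : ∀ f → 1ₚ *ₚ f ≗ f
  *ₚ-identityˡ f zero    = trans (+-identityʳ _) (*-identityˡ (f 0))
  *ₚ-identityˡ f (suc n) = begin
    (1ₚ *ₚ f) (suc n)               ≡⟨ *ₚ-suc 1ₚ f n ⟩
    + 1 * f (suc n) + (0ₚ *ₚ f) n   ≡⟨ cong₂ _+_ (*-identityˡ (f (suc n))) (*ₚ-zeroˡ f n) ⟩
    f (suc n) + + 0                 ≡⟨ +-identityʳ _ ⟩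
    f (suc n)                       ∎

  mono-0 : mono 0 ≗ 1ₚ
  mono-0 zero    = refl
  mono-0 (suc n) = refl

  mono-suc : ∀ d → mono (suc d) ≗ mono 1 *ₚ mono d
  mono-suc d zero    = refl
  mono-suc d (suc n) = begin
    mono d n                             ≡⟨ *ₚ-identityˡ (mono d) n ⟨
    (1ₚ *ₚ mono d) n                     ≡⟨ *ₚ-congʳ (mono d) mono-0 n ⟨
    (mono 0 *ₚ mono d) n                 ≡⟨ +-identityˡ _ ⟨
    + 0 + (mono 0 *ₚ mono d) n           ≡⟨ *ₚ-suc (mono 1) (mono d) n ⟨
    (mono 1 *ₚ mono d) (suc n)           ∎

  mono-< : ∀ {d n} → n ℕ.< d → mono d n ≡ + 0
  mono-< {suc d} {zero}  _         = refl
  mono-< {suc d} {suc n} (s≤s n<d) = mono-< n<d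

  -- The reversed storage makes the `zipWith` in `invRev` a convolution.
  invRev≡ : ∀ f n → invRev f n ≡ map (λ i → inv f (n ℕ.∸ i)) (upTo (suc n))
  invRev≡ f zero    = refl
  invRev≡ f (suc n) = cong (inv f (suc n) ∷_) (trans (invRev≡ f n)
    (trans (List.map-upTo _ (suc n)) (sym (List.map-applyUpTo suc (λ i → inv f (suc n ℕ.∸ i)) (suc n)))))

  zipWith-map : ∀ (f g : ℕ → ℤ) xs → zipWith _*_ (map f xs) (map g xs) ≡ map (λ i → f i * g i) xs
  zipWith-map f g []       = refl
  zipWith-map f g (x ∷ xs) = cong (_ ∷_) (zipWith-map f g xs)

  inv-suc : ∀ f n → inv f (suc n) ≡ - (shift f *ₚ inv f) n
  inv-suc f n = cong (λ l → - sumℤ l)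
    (trans (cong (zipWith _*_ (map (shift f) (upTo (suc n)))) (invRev≡ f n)) (zipWith-map (shift f) _ (upTo (suc n))))

  *ₚ-inverseʳ : ∀ f → f 0 ≡ + 1 → f *ₚ inv f ≗ 1ₚ
  *ₚ-inverseʳ f f0≡1 zero    rewrite f0≡1 = refl
  *ₚ-inverseʳ f f0≡1 (suc n) = begin
    (f *ₚ inv f) (suc n)                            ≡⟨ *ₚ-suc f (inv f) n ⟩
    f 0 * inv f (suc n) + (shift f *ₚ inv f) n      ≡⟨ cong₂ (λ a b → a * b + x) f0≡1 (inv-suc f n) ⟩
    + 1 * - x + x                                   ≡⟨ cong (λ y → y + x) (*-identityˡ (- x)) ⟩
    - x + x                                         ≡⟨ +-inverseˡ x ⟩
    + 0                                             ∎
    where x = (shift f *ₚ inv f) n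

  negₚ : FPS → FPS
  negₚ f n = - f n

  -- ℤ[[q]] modulo q^(N+1).
  truncated : ℕ → CommutativeRing 0ℓ 0ℓ
  truncated N = record
    { Carrier = FPS
    ; _≈_     = λ f g → ∀ i → i ≤ N → f i ≡ g i
    ; _+_     = _+ₚ_
    ; _*_     = _*ₚ_
    ; -_      = negₚ
    ; 0#      = 0ₚ
    ; 1#      = 1ₚ
    ; isCommutativeRing = record
      { isRing = record
        { +-isAbelianGroup = record
          { isGroup = record
            { isMonoid = record
              { isSemigroup = record
                { isMagma = record
                  { isEquivalence = record
                    { refl  = λ _ _ → refl
                    ; sym   = λ f≈g i i≤N → sym (f≈g i i≤N)
                    ; trans = λ f≈g g≈h i i≤N → trans (f≈g i i≤N) (g≈h i i≤N)
                    }
                  ; ∙-cong = λ f≈ g≈ i i≤N → cong₂ _+_ (f≈ i i≤N) (g≈ i i≤N)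
                  }
                ; assoc = λ f g h i _ → +-assoc (f i) (g i) (h i)
                }
              ; identity = (λ f i _ → +-identityˡ (f i)) , (λ f i _ → +-identityʳ (f i))
              }
            ; inverse = (λ f i _ → +-inverseˡ (f i)) , (λ f i _ → +-inverseʳ (f i))
            ; ⁻¹-cong = λ f≈ i i≤N → cong -_ (f≈ i i≤N)
            }
          ; comm = λ f g i _ → +-comm (f i) (g i)
          }
        ; *-cong = λ f≈ g≈ i i≤N → *ₚ-cong-≤ i (λ j j≤i → f≈ j (ℕ.≤-trans j≤i i≤N)) (λ j j≤i → g≈ j (ℕ.≤-trans j≤i i≤N))
        ; *-assoc = λ f g h i _ → *ₚ-assoc f g h i
        ; *-identity = (λ f i _ → *ₚ-identityˡ f i)
                     , (λ f i _ → trans (*ₚ-comm f 1ₚ i) (*ₚ-identityˡ f i))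
        ; distrib = (λ h f g i _ → trans (*ₚ-comm h (f +ₚ g) i)
                      (trans (*ₚ-distribʳ h f g i) (cong₂ _+_ (*ₚ-comm f h i) (*ₚ-comm g h i))))
                  , (λ h f g i _ → *ₚ-distribʳ h f g i)
        }
      ; *-comm = λ f g i _ → *ₚ-comm f g i
      }
    }

-- From the binomial exponents to the quadratic form `e`.

module QuadraticExponents where
  open import Data.Nat using (_+_; _*_; _∸_)
  open import Data.Nat.Properties
  open Exponents using (e)
  open +-*-Solver using (solve; _:+_; _:*_; _:=_; con)
  open ≡ using (refl; sym; trans; cong; cong₂)
  open ≡.≡-Reasoning

  2*[1+m]C2 : ∀ m → 2 * (suc m C 2) ≡ m * m + m
  2*[1+m]C2 zero    = refl
  2*[1+m]C2 (suc m) = begin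
    2 * (suc (suc m) C 2)                ≡⟨ cong (2 *_) (nCk+nC[k+1]≡[n+1]C[k+1] (suc m) 1) ⟨
    2 * (suc m C 1 + suc m C 2)          ≡⟨ *-distribˡ-+ 2 (suc m C 1) (suc m C 2) ⟩
    2 * (suc m C 1) + 2 * (suc m C 2)    ≡⟨ cong₂ (λ a b → 2 * a + b) (nC1≡n (suc m)) (2*[1+m]C2 m) ⟩
    2 * suc m + (m * m + m)              ≡⟨ solve 1 (λ m → con 2 :* (con 1 :+ m) :+ (m :* m :+ m)
                                              := (con 1 :+ m) :* (con 1 :+ m) :+ (con 1 :+ m)) refl m ⟩
    suc m * suc m + suc m                ∎

  quadPart≡ : ∀ m n → quadPart m n ≡ (m * m + m) + (n * n + n) + 2 * m * n
  quadPart≡ m n = cong₂ (λ a b → a + b + 2 * m * n) (2*[1+m]C2 m) (2*[1+m]C2 n)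

  -- `quadPart m n` is (m + n)² + (m + n), so the truncated subtraction loses nothing.
  exp₁≡ : ∀ m n → exp₁ m n ≡ e 0 0 m n
  exp₁≡ m n = begin
    quadPart m n ∸ m ∸ n                  ≡⟨ ∸-+-assoc (quadPart m n) m n ⟩
    quadPart m n ∸ (m + n)                ≡⟨ cong (_∸ (m + n)) (trans (quadPart≡ m n)
      (solve 2 (λ m n → (m :* m :+ m) :+ (n :* n :+ n) :+ con 2 :* m :* n
        := ((m :+ n) :* (m :+ n) :+ con 0 :+ con 0) :+ (m :+ n)) refl m n)) ⟩
    e 0 0 m n + (m + n) ∸ (m + n)         ≡⟨ m+n∸n≡m (e 0 0 m n) (m + n) ⟩
    e 0 0 m n                             ∎

  exp₂≡ : ∀ m n → exp₂ m n ≡ e 1 2 m n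
  exp₂≡ m n = trans (cong (_+ n) (quadPart≡ m n))
    (solve 2 (λ m n → (m :* m :+ m) :+ (n :* n :+ n) :+ con 2 :* m :* n :+ n
      := (m :+ n) :* (m :+ n) :+ con 1 :* m :+ con 2 :* n) refl m n)

  exp₃≡ : ∀ m n → exp₃ m n ≡ e 2 2 m n
  exp₃≡ m n = trans (cong (λ x → x + m + n) (quadPart≡ m n))
    (solve 2 (λ m n → (m :* m :+ m) :+ (n :* n :+ n) :+ con 2 :* m :* n :+ m :+ n
      := (m :+ n) :* (m :+ n) :+ con 2 :* m :+ con 2 :* n) refl m n)

-- Transfer to the partial sums and products modulo q^(N+1).

module Truncation (N K : ℕ) (N<K : suc N ≤ K) where
  open PowerSeries
  open Exponents using (e)
  R : CommutativeRing 0ℓ 0ℓ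
  R = truncated N
  open CommutativeRing R
  open FiniteSums R
  open Algebra.Properties.Semiring.Exp semiring
  open Algebra.Properties.Ring ring using (-‿distribˡ-*)
  open import Relation.Binary.Reasoning.Setoid setoid

  q : FPS
  q = mono 1

  mono≈q^ : ∀ d → mono d ≈ q ^ d
  mono≈q^ zero    i _   = mono-0 i
  mono≈q^ (suc d) i i≤N = ≡.trans (mono-suc d i) (*-congˡ {q} (mono≈q^ d) i i≤N)

  qᴷ≈0 : q ^ K ≈ 0#
  qᴷ≈0 i i≤N = ≡.trans (≡.sym (mono≈q^ K i i≤N)) (mono-< (ℕ.≤-trans (s≤s i≤N) N<K))

  sumₚ≡Σ : ∀ n f → sumₚ (map f (upTo n)) ≡ Σ n f
  sumₚ≡Σ n f = ≡.trans (≡.cong sumₚ (List.map-upTo f n)) (go n f)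
    where
    go : ∀ n f → sumₚ (applyUpTo f n) ≡ Σ n f
    go zero    f = ≡.refl
    go (suc n) f = ≡.cong (f 0 +ₚ_) (go n (f ∘ suc))

  prodₚ≡Π : ∀ n f → prodₚ (map f (upTo n)) ≡ Π n f
  prodₚ≡Π n f = ≡.trans (≡.cong prodₚ (List.map-upTo f n)) (go n f)
    where
    go : ∀ n f → prodₚ (applyUpTo f n) ≡ Π n f
    go zero    f = ≡.refl
    go (suc n) f = ≡.cong (f 0 *ₚ_) (go n (f ∘ suc))

  poch≈ : ∀ a b n {A B} → A ≈ q ^ a → B ≈ q ^ b → poch a b n ≈ pochhammer A B n
  poch≈ a b n {A} {B} A≈ B≈ = trans (reflexive (prodₚ≡Π n _)) (Π-cong n factor)
    where
    factor : ∀ j → 1ₚ -ₚ mono (a ℕ.+ b ℕ.* j) ≈ 1# - A * B ^ j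
    factor j = +-congˡ {1ₚ} (-‿cong (begin
      mono (a ℕ.+ b ℕ.* j)        ≈⟨ mono≈q^ (a ℕ.+ b ℕ.* j) ⟩
      q ^ (a ℕ.+ b ℕ.* j)         ≈⟨ ^-homo-* q a (b ℕ.* j) ⟩
      q ^ a * q ^ (b ℕ.* j)       ≈⟨ *-cong A≈ (trans (^-congˡ j B≈) (^-assocʳ q b j)) ⟨
      A * B ^ j                   ∎))

  Π-constant : ∀ n f → (∀ i → f i 0 ≡ + 1) → Π n f 0 ≡ + 1
  Π-constant zero    f f0≡1 = ≡.refl
  Π-constant (suc n) f f0≡1 =
    ≡.trans (*ₚ-0 (f 0) (Π n (f ∘ suc))) (≡.cong₂ ℤ._*_ (f0≡1 0) (Π-constant n (f ∘ suc) (f0≡1 ∘ suc)))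

  poch-constant : ∀ a b n .{{_ : ℕ.NonZero a}} → poch a b n 0 ≡ + 1
  poch-constant (suc a) b n = ≡.trans (≡.cong (λ f → f 0) (prodₚ≡Π n _)) (Π-constant n _ (λ _ → ≡.refl))

  inv-inverseʳ : ∀ f → f 0 ≡ + 1 → f * inv f ≈ 1#
  inv-inverseʳ f f0≡1 i _ = *ₚ-inverseʳ f f0≡1 i

  -- Characterises `inv` modulo q^(N+1), so its recursion is never unfolded again.
  inv-unique : ∀ f g → f 0 ≡ + 1 → f * g ≈ 1# → g ≈ inv f
  inv-unique f g f0≡1 fg≈1 = begin
    g                  ≈⟨ *-identityˡ g ⟨
    1# * g             ≈⟨ *-congʳ {g} (inv-inverseʳ f f0≡1) ⟨
    f * inv f * g      ≈⟨ *-congʳ {g} (*-comm f (inv f)) ⟩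
    inv f * f * g      ≈⟨ *-assoc (inv f) f g ⟩
    inv f * (f * g)    ≈⟨ *-congˡ {inv f} fg≈1 ⟩
    inv f * 1#         ≈⟨ *-identityʳ (inv f) ⟩
    inv f              ∎

  -- Supplies `u-suc` for a = 0 and `v-suc` for a = 1.
  inv-poch-suc : ∀ a n {A} → A ≈ q ^ suc a →
    (1# - A ^ suc n) * inv (poch (suc a) (suc a) (suc n)) ≈ inv (poch (suc a) (suc a) n)
  inv-poch-suc a n {A} A≈ = inv-unique _ _ (poch-constant (suc a) (suc a) n) (begin
    poch (suc a) (suc a) n * ((1# - A ^ suc n) * w)     ≈⟨ *-assoc (poch (suc a) (suc a) n) (1# - A ^ suc n) w ⟨
    poch (suc a) (suc a) n * (1# - A ^ suc n) * w       ≈⟨ *-congʳ {w} (*-congʳ {1# - A ^ suc n} (poch≈ (suc a) (suc a) n A≈ A≈)) ⟩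
    pochhammer A A n * (1# - A ^ suc n) * w             ≈⟨ *-congʳ {w} (pochhammer-suc A A n) ⟨
    pochhammer A A (suc n) * w                          ≈⟨ *-congʳ {w} (poch≈ (suc a) (suc a) (suc n) A≈ A≈) ⟨
    poch (suc a) (suc a) (suc n) * w                    ≈⟨ inv-inverseʳ (poch (suc a) (suc a) (suc n)) (poch-constant (suc a) (suc a) (suc n)) ⟩
    1#                                                  ∎)
    where w = inv (poch (suc a) (suc a) (suc n))

  inv-1 : inv 1ₚ ≈ 1#
  inv-1 = sym (inv-unique 1ₚ 1ₚ ≡.refl (*-identityˡ 1ₚ))

  open RogersSelberg.WithInverses R q K (ℕ.≤-trans (s≤s z≤n) N<K) qᴷ≈0
    (λ m → inv (poch 1 1 m)) (λ n → inv (poch 2 2 n)) inv-1 inv-1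
    (λ m → inv-poch-suc 0 m (sym (*-identityʳ q))) (λ n → inv-poch-suc 1 n refl)
    public using (sgn; G; p; identity₁; identity₂; identity₃)

  scale≈sgn : ∀ n f → scale ((ℤ.- + 1) ℤ.^ n) f ≈ sgn n * f
  scale≈sgn zero    f i i≤N = ≡.trans (ℤ.*-identityˡ (f i)) (≡.sym (*-identityˡ f i i≤N))
  scale≈sgn (suc n) f = trans neg (trans (-‿cong (scale≈sgn n f)) (-‿distribˡ-* (sgn n) f))
    where
    neg : scale ((ℤ.- + 1) ℤ.^ suc n) f ≈ - scale ((ℤ.- + 1) ℤ.^ n) f
    neg i _ = ≡.trans (ℤ.*-assoc (ℤ.- + 1) ((ℤ.- + 1) ℤ.^ n) (f i)) (ℤ.-1*i≡-i _)

  lhs≈G : ∀ a b {ε : ℕ → ℕ → ℕ} → (∀ m n → ε m n ≡ e a b m n) → lhsPartial ε K ≈ G a b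
  lhs≈G a b {ε} ε≡ = trans (reflexive (sumₚ≡Σ K _)) (Σ-cong K (λ m →
    trans (reflexive (sumₚ≡Σ K _)) (Σ-cong K (λ n →
      trans (scale≈sgn n _) (*-congˡ {sgn n} (*-congʳ {inv (poch 1 1 m) * inv (poch 2 2 n)}
        (trans (mono≈q^ (ε m n)) (reflexive (≡.cong (q ^_) (ε≡ m n))))))))))

  poch≈p : ∀ r → poch (2 ℕ.* r) 14 K ≈ p r
  poch≈p r = poch≈ (2 ℕ.* r) 14 K (^-assocʳ q 2 r) (^-assocʳ q 2 7)

  -- The residues enter as successors so that each product has constant term 1 and hence an inverse.
  conclude : ∀ a b {ε : ℕ → ℕ → ℕ} r₁ r₂ r₃ r₄ → (∀ m n → ε m n ≡ e a b m n) →
    p (suc r₁) * (p (suc r₂) * (p (suc r₃) * p (suc r₄))) * G a b ≈ 1# →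
    lhsPartial ε K N ≡ rhsPartial (2 ℕ.* suc r₁) (2 ℕ.* suc r₂) (2 ℕ.* suc r₃) (2 ℕ.* suc r₄) K N
  conclude a b r₁ r₂ r₃ r₄ ε≡ pG≈1 = inv-unique P _ P0≡1 (begin
    P * _       ≈⟨ *-cong {P} P≈p (lhs≈G a b ε≡) ⟩
    _           ≈⟨ pG≈1 ⟩
    1#          ∎) N ℕ.≤-refl
    where
    P₁ = poch (2 ℕ.* suc r₁) 14 K
    P₂ = poch (2 ℕ.* suc r₂) 14 K
    P₃ = poch (2 ℕ.* suc r₃) 14 K
    P₄ = poch (2 ℕ.* suc r₄) 14 K
    P = P₁ *ₚ (P₂ *ₚ (P₃ *ₚ P₄))
    P≈p : P ≈ p (suc r₁) * (p (suc r₂) * (p (suc r₃) * p (suc r₄)))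
    P≈p = *-cong {P₁} (poch≈p (suc r₁)) (*-cong {P₂} (poch≈p (suc r₂)) (*-cong {P₃} (poch≈p (suc r₃)) (poch≈p (suc r₄))))
    *-constant : ∀ f g → f 0 ≡ + 1 → g 0 ≡ + 1 → (f *ₚ g) 0 ≡ + 1
    *-constant f g f0≡1 g0≡1 = ≡.trans (*ₚ-0 f g) (≡.cong₂ ℤ._*_ f0≡1 g0≡1)
    P0≡1 : P 0 ≡ + 1
    P0≡1 = *-constant P₁ (P₂ *ₚ (P₃ *ₚ P₄)) (poch-constant (2 ℕ.* suc r₁) 14 K)
      (*-constant P₂ (P₃ *ₚ P₄) (poch-constant (2 ℕ.* suc r₂) 14 K)
        (*-constant P₃ P₄ (poch-constant (2 ℕ.* suc r₃) 14 K) (poch-constant (2 ℕ.* suc r₄) 14 K)))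

open QuadraticExponents

theorem3 : Identity exp₁ 2 4 10 12 × Identity exp₂ 2 6 8 12 × Identity exp₃ 4 6 8 10
theorem3 =
    -- K > N already makes q^K zero modulo q^(N+1). After a and b come the numbers r with base
    -- exponents 2(r + 1).
    (λ N → suc N , λ K N<K → let open Truncation N K N<K in conclude 0 0 0 1 4 5 exp₁≡ identity₁)
  , (λ N → suc N , λ K N<K → let open Truncation N K N<K in conclude 1 2 0 2 3 5 exp₂≡ identity₂)
  , (λ N → suc N , λ K N<K → let open Truncation N K N<K in conclude 2 2 1 2 3 4 exp₃≡ identity₃)
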